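{- Let $\varphi=(V,\mathcal C)$ be a Boolean CSP instance with $m$ constraints that is equipped with local constraint gadgets $(\Sigma_j,\mathrm{var},\ell,P_j,P_j')_{j\in[m]}$ of size $B$ with constants $A\ge0$ and $\Delta>0$ (satisfying the local score condition given in the context), and suppose that the global balance condition $|\Sigma_x^0|=|\Sigma_x^1|$ holds for every $x\in V$. Let $\Pi_\varphi=\{L_1,L_2,R_1,R_2\}$ be the four-permutation Ulam median instance constructed from these gadgets as in the context. Then $$\mathrm{OPT}_{\mathrm{med}}(\Pi_\varphi)=\left(\frac{5B}{2}-A\right)m-\Delta\cdot\mathrm{OPT}_{\mathrm{CSP}}(\varphi).$$
   Context: Permutations and Ulam median. A permutation of a finite alphabet $\Gamma$ is a string containing each symbol of $\Gamma$ exactly once; $\mathcal P(\Gamma)$ is the set of these. For $\pi\in\mathcal P(\Gamma)$ and $S\subseteq\Gamma$, $\pi|_S$ is the subsequence of $\pi$ consisting of the symbols in $S$. $\mathrm{LCS}(x,y)$ is the length of a longest common subsequence; $\mathcal U(x,y)=|\Gamma|-\mathrm{LCS}(x,y)$ for $x,y\in\mathcal P(\Gamma)$. For a multiset $\Pi$ of permutations of $\Gamma$, $\mathrm{OPT}_{\mathrm{med}}(\Pi)=\min_{\sigma\in\mathcal P(\Gamma)}\sum_{\pi\in\Pi}\mathcal U(\sigma,\pi)$. CSP. A Boolean CSP instance $\varphi=(V,\mathcal C)$ has Boolean variables $V=\{x_1,\ldots,x_n\}$ and a list of constraints $\mathcal C=(C_1,\ldots,C_m)$; $C_j$ depends on the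 variables $V_j\subseteq V$. For $f:V\to\{0,1\}$, $\mathrm{Val}_\varphi(f)$ is the number of $j\in[m]$ such that $f$ satisfies $C_j$, and $\mathrm{OPT}_{\mathrm{CSP}}(\varphi)=\max_f\mathrm{Val}_\varphi(f)$. Local gadgets. For each $j$, $\Sigma_j$ is an alphabet of exactly $B$ symbols ($B$ a fixed positive integer), with $\Sigma_1,\ldots,\Sigma_m$ pairwise disjoint; $\Sigma=\Sigma_1\sqcup\cdots\sqcup\Sigma_m$ and $N=|\Sigma|=Bm$. Each $\sigma\in\Sigma_j$ has a variable $\mathrm{var}(\sigma)\in V_j$ and a label $\ell(\sigma)\in\{0,1\}$. For a local assignment $a:V_j\to\{0,1\}$, $\mathrm{Agr}_j(a)=\{\sigma\in\Sigma_j: a(\mathrm{var}(\sigma))=\ell(\sigma)\}$. The permutations $P_j,P_j'\in\mathcal P(\Sigma_j)$ satisfy the local score condition: for every $a:V_j\to\{0,1\}$, $\mathrm{LCS}(P_j|_{\mathrm{Agr}_j(a)},P_j'|_{\mathrm{Agr}_j(a)})$ equals $A+\Delta$ if $a$ satisfies $C_j$ and equals $A$ otherwise, where $A\ge0$, $\Delta>0$ do not depend on $j$. Global balance. For $x\in V$, $b\in\{0,1\}$, $\Sigma_x^b=\{\sigma\in\Sigma:\mathrm{var}(\sigma)=x,\ \ell(\sigma)=b\}$; the condition is $|\Sigma_x^0|=|\Sigma_x^1|$ for all $x\in V$. Construction of $\Pi_\varphi$. Let $\beta_1=P_1P_2\cdots P_m$ and $\beta_2=P_1'P_2'\cdots P_m'$.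 Let $B_x^b$ be the string listing the symbols of $\Sigma_x^b$ in some fixed order, $\alpha_1=B_{x_1}^0B_{x_1}^1\cdots B_{x_n}^0B_{x_n}^1$ and $\alpha_2=B_{x_1}^1B_{x_1}^0\cdots B_{x_n}^1B_{x_n}^0$. Let $M=2N+1$, let $\Sigma_Z=\{z_1,\ldots,z_M\}$ be disjoint from $\Sigma$, and $Z=z_1z_2\cdots z_M$. Set $L_1=\beta_1Z$, $L_2=\beta_2Z$, $R_1=Z\alpha_1$, $R_2=Z\alpha_2$, all permutations of $\Sigma\sqcup\Sigma_Z$. -}

module Defs where

open import Data.Bool using (Bool; true; false; if_then_else_)
open import Data.Bool.Properties using () renaming (_≟_ to _≟ᵇ_)
open import Data.Fin using (Fin; zero; suc)
import Data.Fin.Properties as Fin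
open import Data.Fin.Subset using (Subset) renaming (_∈_ to _∈ₛ_)
open import Data.Integer using (+_)
open import Data.List using (List; []; _∷_; [_]; _++_; map; concatMap; filter; length; allFin)
open import Data.List.Extrema.Nat using (max; min)
open import Data.List.Membership.Propositional using (_∈_)
import Data.List.Membership.DecPropositional as DecMembership
import Data.List.Relation.Binary.Sublist.DecPropositional as DecSublist
open import Data.List.Relation.Unary.Unique.Propositional using (Unique)
import Data.List.Relation.Unary.Unique.DecPropositional as DecUnique
open import Data.Nat using (ℕ; zero; suc; _+_; _*_; _∸_)
open import Data.Nat.ListAction using (sum)
open import Data.Product using (Σ; _×_; _,_; proj₁; proj₂)
open import Data.Product.Function.Dependent.Propositional using (Σ-↔)
open import Data.Rational using (ℚ; _/_) renaming (_+_ to _+ℚ_)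
open import Data.Sum using (_⊎_; inj₁; inj₂)
open import Data.Sum.Function.Propositional using (_⊎-↔_)
open import Data.Vec.Functional using () renaming (_∷_ to _∷ᶠ_; [] to []ᶠ)
open import Function using (_∘_)
open import Function.Bundles using (_↔_; _⇔_; module Inverse)
open import Function.Construct.Composition using (_↔-∘_)
open import Function.Construct.Identity using (↔-id)
open import Function.Construct.Symmetry using (↔-sym)
open import Function.Properties.Inverse using (↔⇒↣)
open import Relation.Binary.Definitions using (DecidableEquality)
open import Relation.Binary.PropositionalEquality using (_≡_; _≗_; subst)
open import Relation.Nullary.Decidable using (map′; via-injection; _×-dec_)
open import Relation.Unary using (Pred; Decidable)

fromℕ : ℕ → ℚ
fromℕ k = + k / 1

------------------------------------------------------------------------
-- Alphabets, strings, permutations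

record Alphabet (k : ℕ) : Set₁ where
  field
    Symbol : Set
    enum   : Symbol ↔ Fin k

  _≟_ : DecidableEquality Symbol
  _≟_ = via-injection (↔⇒↣ enum) Fin._≟_

  symbols : List Symbol
  symbols = map (Inverse.from enum) (allFin k)

open Alphabet using (Symbol; symbols)

finAlphabet : (k : ℕ) → Alphabet k
finAlphabet k = record { Symbol = Fin k ; enum = ↔-id (Fin k) }

_⊕_ : ∀ {k l} → Alphabet k → Alphabet l → Alphabet (k + l)
Γ ⊕ Θ = record
  { Symbol = Symbol Γ ⊎ Symbol Θ
  ; enum   = ↔-sym Fin.+↔⊎ ↔-∘ (Alphabet.enum Γ ⊎-↔ Alphabet.enum Θ)
  }

⨁ : ∀ {m k} → (Fin m → Alphabet k) → Alphabet (m * k)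
⨁ {m} Γ = record
  { Symbol = Σ (Fin m) (λ j → Symbol (Γ j))
  ; enum   = ↔-sym Fin.*↔× ↔-∘ Σ-↔ (↔-id (Fin m)) (λ {j} → Alphabet.enum (Γ j))
  }

IsPermutation : ∀ {k} (Γ : Alphabet k) → List (Symbol Γ) → Set
IsPermutation Γ w = Unique w × (∀ s → s ∈ w)

isPermutation? : ∀ {k} (Γ : Alphabet k) → Decidable (IsPermutation Γ)
isPermutation? Γ w =
  DecUnique.unique? _≟_ w ×-dec
  map′ (λ h s → subst (_∈ w) (Inverse.strictlyInverseʳ enum s) (h (Inverse.to enum s)))
       (λ h i → h (Inverse.from enum i))
       (Fin.all? (λ i → DecMembership._∈?_ _≟_ (Inverse.from enum i) w))
  where open Alphabet Γ using (_≟_; enum)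

words : ∀ {k} (Γ : Alphabet k) → ℕ → List (List (Symbol Γ))
words Γ zero    = [ [] ]
words Γ (suc l) = concatMap (λ w → map (_∷ w) (symbols Γ)) (words Γ l)

permutations : ∀ {k} (Γ : Alphabet k) → List (List (Symbol Γ))
permutations {k} Γ = filter (isPermutation? Γ) (words Γ k)

------------------------------------------------------------------------
-- Ulam distance and median

subsequences : ∀ {A : Set} → List A → List (List A)
subsequences []       = [ [] ]
subsequences (x ∷ xs) = map (x ∷_) (subsequences xs) ++ subsequences xs

LCS : ∀ {k} (Γ : Alphabet k) → List (Symbol Γ) → List (Symbol Γ) → ℕ
LCS Γ x y = max 0 (map length (filter (λ w → w ⊆? y) (subsequences x)))
  where open DecSublist (Alphabet._≟_ Γ) using (_⊆?_)

-- Only meaningful when both strings are permutations of Γ; the truncated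
-- subtraction then does not truncate.
ulam : ∀ {k} (Γ : Alphabet k) → List (Symbol Γ) → List (Symbol Γ) → ℕ
ulam {k} Γ x y = k ∸ LCS Γ x y

medianCost : ∀ {k} (Γ : Alphabet k) → List (List (Symbol Γ)) → List (Symbol Γ) → ℕ
medianCost Γ Π σ = sum (map (ulam Γ σ) Π)

-- The library's minimum of a list takes a default, which also competes for
-- the minimum.  `symbols Γ` is itself a permutation of Γ, so the
-- default does not affect the value.
OPTmed : ∀ {k} (Γ : Alphabet k) → List (List (Symbol Γ)) → ℕ
OPTmed Γ Π = min (medianCost Γ Π (symbols Γ)) (map (medianCost Γ Π) (permutations Γ))

------------------------------------------------------------------------
-- Boolean CSPs

LocalAssignment : ∀ {n} → Subset n → Set
LocalAssignment {n} V = Σ (Fin n) (_∈ₛ V) → Bool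

record Constraint (n : ℕ) : Set where
  field
    vars     : Subset n
    sat      : LocalAssignment vars → Bool
    -- Assignments are functions, compared pointwise; without function
    -- extensionality, `sat` must be required to respect this.
    sat-cong : ∀ {a b} → a ≗ b → sat a ≡ sat b

open Constraint

CSP : ℕ → ℕ → Set
CSP n m = Fin m → Constraint n

Val : ∀ {n m} → CSP n m → (Fin n → Bool) → ℕ
Val {m = m} φ f = length (filter (λ j → sat (φ j) (f ∘ proj₁) ≟ᵇ true) (allFin m))

assignments : (n : ℕ) → List (Fin n → Bool)
assignments zero    = [ []ᶠ ]
assignments (suc n) = concatMap (λ f → (false ∷ᶠ f) ∷ (true ∷ᶠ f) ∷ []) (assignments n)

OPTcsp : ∀ {n m} → CSP n m → ℕ
OPTcsp {n} φ = max 0 (map (Val φ) (assignments n))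

------------------------------------------------------------------------
-- Local gadgets; the labels 0 and 1 are false and true

record Gadget {n : ℕ} (C : Constraint n) (B : ℕ) : Set₁ where
  field
    alphabet : Alphabet B
    var      : Symbol alphabet → Σ (Fin n) (_∈ₛ vars C)
    label    : Symbol alphabet → Bool
    P P′     : List (Symbol alphabet)
    P-perm   : IsPermutation alphabet P
    P′-perm  : IsPermutation alphabet P′

  Agr : LocalAssignment (vars C) → Pred (Symbol alphabet) _
  Agr a σ = a (var σ) ≡ label σ

  Agr? : (a : LocalAssignment (vars C)) → Decidable (Agr a)
  Agr? a σ = a (var σ) ≟ᵇ label σ

LocalScore : ∀ {n B} {C : Constraint n} → Gadget C B → ℚ → ℚ → Set
LocalScore {C = C} G A Δ =
  ∀ (a : LocalAssignment (vars C)) →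
  fromℕ (LCS alphabet (filter (Agr? a) P) (filter (Agr? a) P′))
    ≡ (if sat C a then A +ℚ Δ else A)
  where open Gadget G

Gadgets : ∀ {n m} → CSP n m → ℕ → Set₁
Gadgets φ B = ∀ j → Gadget (φ j) B

module _ {n m B : ℕ} {φ : CSP n m} (G : Gadgets φ B) where

  Σ-alphabet : Alphabet (m * B)
  Σ-alphabet = ⨁ (λ j → Gadget.alphabet (G j))

  varΣ : Symbol Σ-alphabet → Fin n
  varΣ (j , σ) = proj₁ (Gadget.var (G j) σ)

  labelΣ : Symbol Σ-alphabet → Bool
  labelΣ (j , σ) = Gadget.label (G j) σ

  InBlock : Fin n → Bool → Pred (Symbol Σ-alphabet) _
  InBlock x b σ = varΣ σ ≡ x × labelΣ σ ≡ b

  inBlock? : ∀ x b → Decidable (InBlock x b)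
  inBlock? x b σ = (varΣ σ Fin.≟ x) ×-dec (labelΣ σ ≟ᵇ b)

  blockSize : Fin n → Bool → ℕ
  blockSize x b = length (filter (inBlock? x b) (symbols Σ-alphabet))

  Balanced : Set
  Balanced = ∀ x → blockSize x false ≡ blockSize x true

  record BlockOrder : Set where
    field
      block        : Fin n → Bool → List (Symbol Σ-alphabet)
      block-unique : ∀ x b → Unique (block x b)
      block-lists  : ∀ x b σ → σ ∈ block x b ⇔ InBlock x b σ

------------------------------------------------------------------------
-- The median instance

  M : ℕ
  M = 2 * (m * B) + 1

  medianAlphabet : Alphabet (m * B + M)
  medianAlphabet = Σ-alphabet ⊕ finAlphabet M

  β₁ β₂ : List (Symbol Σ-alphabet)
  β₁ = concatMap (λ j → map (j ,_) (Gadget.P  (G j))) (allFin m)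
  β₂ = concatMap (λ j → map (j ,_) (Gadget.P′ (G j))) (allFin m)

  α₁ α₂ : BlockOrder → List (Symbol Σ-alphabet)
  α₁ O = concatMap (λ x → block x false ++ block x true) (allFin n)
    where open BlockOrder O
  α₂ O = concatMap (λ x → block x true ++ block x false) (allFin n)
    where open BlockOrder O

  Z : List (Symbol medianAlphabet)
  Z = map inj₂ (allFin M)

  L₁ L₂ : List (Symbol medianAlphabet)
  L₁ = map inj₁ β₁ ++ Z
  L₂ = map inj₁ β₂ ++ Z

  R₁ R₂ : BlockOrder → List (Symbol medianAlphabet)
  R₁ O = Z ++ map inj₁ (α₁ O)
  R₂ O = Z ++ map inj₁ (α₂ O)

  Π[_] : BlockOrder → List (List (Symbol medianAlphabet))
  Π[ O ] = L₁ ∷ L₂ ∷ R₁ O ∷ R₂ O ∷ []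

module Submission where

-- Write N = |Σ| = 2h.  A common subsequence of σ with βᵢZ and one with Zαₖ can share a symbol of Σ
-- only by giving up M > 2N symbols of Z, and then σ costs more than 5h.  Otherwise the symbols matched
-- in the βᵢ are disjoint from those matched in the αₖ, and by inclusion–exclusion σ costs at least
-- 6h − |b| − |a|, where b is common to β₁ and β₂, and a, disjoint from b, is common to α₁ and α₂.
-- Since α₁ and α₂ order the two blocks of a variable oppositely, a uses a single label per variable,
-- so it consists of symbols disagreeing with some assignment f.  These number h by balance, whence
-- |a| + |b| ≤ h + Σⱼ LCS(Pⱼ|Agr f, Pⱼ′|Agr f).  Conversely, listing the symbols that agree with f
-- in the order of β₁, then Z, then the disagreeing ones attains equality.

open import Defs
open import Data.Bool using (Bool; true; false; not; if_then_else_)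
open import Data.Bool.Properties as Bool using (not-¬; not-involutive)
open import Data.Empty using (⊥; ⊥-elim)
open import Data.Fin as Fin using (Fin)
open import Data.Integer using (+_)
import Data.Integer as ℤ
import Data.Integer.Properties as ℤ
open import Data.List using (List; []; _∷_; [_]; _++_; map; concatMap; filter; length; allFin)
import Data.List.Properties as List
open import Data.List.Extrema.Nat using (argmax-sel; xs≤max; min≤v⁺; v≤min⁺)
open import Data.List.Membership.Propositional using (_∈_; _∉_; find; lose)
open import Data.List.Membership.Propositional.Properties
import Data.List.Membership.DecPropositional as DecMembership
open import Data.List.Relation.Binary.Disjoint.Propositional using (Disjoint)
open import Data.List.Relation.Binary.Sublist.Propositional
  using (_⊆_; []; _∷_; _∷ʳ_; ⊆-trans; ⊆-refl; lookup; minimum; from∈)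
import Data.List.Relation.Binary.Sublist.Propositional.Properties as Sub
import Data.List.Relation.Binary.Sublist.DecPropositional as DecSublist
open import Data.List.Relation.Unary.All as All using (All; []; _∷_)
import Data.List.Relation.Unary.All.Properties as All
open import Data.List.Relation.Unary.AllPairs as AllPairs using (AllPairs; []; _∷_)
import Data.List.Relation.Unary.AllPairs.Properties as AllPairs
open import Data.List.Relation.Unary.Any as Any using (here; there)
import Data.List.Relation.Unary.Any.Properties as Any
open import Data.List.Relation.Unary.Unique.Propositional using (Unique)
import Data.List.Relation.Unary.Unique.Propositional.Properties as Unique
open import Data.Nat as ℕ using (ℕ; zero; suc; NonZero; _+_; _∸_; z≤n; s≤s) renaming (_*_ to _*ℕ_)
import Data.Nat.Properties as ℕ
open import Data.Nat.ListAction using (sum)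
open import Data.Nat.Tactic.RingSolver using (solve-∀)
open import Data.Product using (∃; ∃₂; _×_; _,_; proj₁; proj₂)
import Data.Rational as ℚ
open import Data.Rational using (ℚ; 0ℚ; _≤_; _<_; _/_; _*_; _-_; toℚᵘ) renaming (_+_ to _+ℚ_)
import Data.Rational.Properties as ℚ
open import Data.Rational.Solver using (module +-*-Solver)
open import Data.Rational.Unnormalised as ℚᵘ using (mkℚᵘ; *≡*; *≤*) renaming (_≃_ to _≃ᵘ_)
import Data.Rational.Unnormalised.Properties as ℚᵘ
import Data.Sum as Sum
open import Data.Sum using (_⊎_; inj₁; inj₂)
open import Data.Sum.Properties using (inj₁-injective; inj₂-injective)
open import Data.Vec.Functional using () renaming (_∷_ to _∷ᶠ_)
open import Function using (_∘_)
open import Function.Bundles using (module Inverse; module Equivalence)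
open import Level using (0ℓ)
open import Relation.Binary.Core using (Rel)
open import Relation.Binary.Definitions using (DecidableEquality)
open import Relation.Binary.PropositionalEquality
  using (_≡_; _≢_; refl; sym; trans; cong; cong₂; subst; subst₂; module ≡-Reasoning)
open import Relation.Nullary using (¬_; Dec; yes; no; ¬?; does)
open import Relation.Unary using (Pred; Decidable)
open Alphabet using (Symbol; symbols)

-- Sublists and duplicate-free words

private variable
  A C : Set
  xs ys zs : List A

AllPairs-resp-⊆ : ∀ {R : Rel A 0ℓ} → xs ⊆ ys → AllPairs R ys → AllPairs R xs
AllPairs-resp-⊆ []         []         = []
AllPairs-resp-⊆ (_ ∷ʳ τ)   (_ ∷ rs)   = AllPairs-resp-⊆ τ rs
AllPairs-resp-⊆ (refl ∷ τ) (rx ∷ rs)  = Sub.All-resp-⊆ τ rx ∷ AllPairs-resp-⊆ τ rs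

AllPairs-lookup : ∀ {R : Rel A 0ℓ} → (∀ {a} → R a a) → (∀ {a b} → R a b → R b a) →
                  AllPairs R xs → ∀ {a b} → a ∈ xs → b ∈ xs → R a b
AllPairs-lookup r s (rx ∷ rs) (here refl) (here refl) = r
AllPairs-lookup r s (rx ∷ rs) (here refl) (there j)   = All.lookup rx j
AllPairs-lookup r s (rx ∷ rs) (there i)   (here refl) = s (All.lookup rx i)
AllPairs-lookup r s (rx ∷ rs) (there i)   (there j)   = AllPairs-lookup r s rs i j

length-≤-Unique : Unique xs → (∀ {a} → a ∈ xs → a ∈ ys) → length xs ℕ.≤ length ys
length-≤-Unique [] _ = z≤n
length-≤-Unique {xs = x ∷ xs} {ys = ys} (x∉xs ∷ uxs) inc
  with us , vs , refl ← ∈-∃++ (inc (here refl)) =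
  ℕ.≤-trans (s≤s (length-≤-Unique uxs inc′)) (ℕ.≤-reflexive (sym (List.length-++-sucʳ us x vs)))
  where
  inc′ : ∀ {a} → a ∈ xs → a ∈ us ++ vs
  inc′ a∈xs with ∈-++⁻ us (inc (there a∈xs))
  ... | inj₁ a∈us         = ∈-++⁺ˡ a∈us
  ... | inj₂ (here a≡x)   = ⊥-elim (All.lookup x∉xs a∈xs (sym a≡x))
  ... | inj₂ (there a∈vs) = ∈-++⁺ʳ us a∈vs

⊆-++⁻ : ∀ ys → xs ⊆ ys ++ zs → ∃₂ λ us vs → xs ≡ us ++ vs × us ⊆ ys × vs ⊆ zs
⊆-++⁻ []       τ          = [] , _ , refl , [] , τ
⊆-++⁻ (y ∷ ys) (_ ∷ʳ τ)   with us , vs , eq , τ₁ , τ₂ ← ⊆-++⁻ ys τ = us , vs , eq , y ∷ʳ τ₁ , τ₂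
⊆-++⁻ (y ∷ ys) (refl ∷ τ) with us , vs , eq , τ₁ , τ₂ ← ⊆-++⁻ ys τ =
  y ∷ us , vs , cong (y ∷_) eq , refl ∷ τ₁ , τ₂

⊆-map⁻ : ∀ (f : A → C) ys {xs} → xs ⊆ map f ys → ∃ λ us → xs ≡ map f us × us ⊆ ys
⊆-map⁻ f []       []         = [] , refl , []
⊆-map⁻ f (y ∷ ys) (_ ∷ʳ τ)   with us , eq , τ′ ← ⊆-map⁻ f ys τ = us , eq , y ∷ʳ τ′
⊆-map⁻ f (y ∷ ys) (refl ∷ τ) with us , eq , τ′ ← ⊆-map⁻ f ys τ = y ∷ us , cong (f y ∷_) eq , refl ∷ τ′

-- In a duplicate-free `zs` every element has one position, so a sublist is determined by its set of
-- elements, and inclusion of the sets already gives inclusion in order.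
⊆-Unique-inclusion : Unique zs → xs ⊆ zs → ys ⊆ zs → (∀ {a} → a ∈ xs → a ∈ ys) → xs ⊆ ys
⊆-Unique-inclusion []       []         []         inc = []
⊆-Unique-inclusion (z∉ ∷ u) (_ ∷ʳ τ)   (_ ∷ʳ υ)   inc = ⊆-Unique-inclusion u τ υ inc
⊆-Unique-inclusion (z∉ ∷ u) (_ ∷ʳ τ)   (refl ∷ υ) inc = _ ∷ʳ ⊆-Unique-inclusion u τ υ inc′
  where
  inc′ : ∀ {a} → a ∈ _ → a ∈ _
  inc′ a∈ with inc a∈
  ... | here refl = ⊥-elim (All.lookup z∉ (lookup τ a∈) refl)
  ... | there a∈′ = a∈′
⊆-Unique-inclusion (z∉ ∷ u) (refl ∷ τ) (_ ∷ʳ υ)   inc =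
  ⊥-elim (All.lookup z∉ (lookup υ (inc (here refl))) refl)
⊆-Unique-inclusion (z∉ ∷ u) (refl ∷ τ) (refl ∷ υ) inc = refl ∷ ⊆-Unique-inclusion u τ υ inc′
  where
  inc′ : ∀ {a} → a ∈ _ → a ∈ _
  inc′ a∈ with inc (there a∈)
  ... | here refl = ⊥-elim (All.lookup z∉ (lookup τ a∈) refl)
  ... | there a∈′ = a∈′

-- Both embeddings must send `s` to its only position in `zs`; `p` then lies before that position
-- and `q` after it. `crossing` glues in this way two matchings that share a symbol.
⊆-Unique-glue : ∀ p {s : A} {q} → Unique zs → p ++ [ s ] ⊆ zs → s ∷ q ⊆ zs → p ++ s ∷ q ⊆ zs
⊆-Unique-glue []      u        τ          υ          = υ
⊆-Unique-glue (_ ∷ p) (z∉ ∷ u) (_ ∷ʳ τ)   (_ ∷ʳ υ)   = _ ∷ʳ ⊆-Unique-glue (_ ∷ p) u τ υ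
⊆-Unique-glue (_ ∷ p) (z∉ ∷ u) (_ ∷ʳ τ)   (refl ∷ υ) =
  ⊥-elim (All.lookup z∉ (lookup τ (there (∈-++⁺ʳ p (here refl)))) refl)
⊆-Unique-glue (_ ∷ p) (z∉ ∷ u) (refl ∷ τ) (_ ∷ʳ υ)   = refl ∷ ⊆-Unique-glue p u τ υ
⊆-Unique-glue (_ ∷ p) (z∉ ∷ u) (refl ∷ τ) (refl ∷ υ) =
  ⊥-elim (All.lookup z∉ (lookup τ (∈-++⁺ʳ p (here refl))) refl)

-- The cut is forced: it falls just before the first element that violates `P`.
++-split-unique : ∀ {P : Pred A 0ℓ} {us vs us′ vs′} → us ++ vs ≡ us′ ++ vs′ →
                  All P us → All (¬_ ∘ P) vs → All P us′ → All (¬_ ∘ P) vs′ → us ≡ us′ × vs ≡ vs′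
++-split-unique {us = []}    {us′ = []}     eq   []       nv       []         nv′        = refl , eq
++-split-unique {us = []}    {us′ = _ ∷ _}  refl []       (n ∷ _)  (p ∷ _)    nv′        = ⊥-elim (n p)
++-split-unique {us = _ ∷ _} {us′ = []}     refl (p ∷ _)  nv       []         (n ∷ _)    = ⊥-elim (n p)
++-split-unique {us = _ ∷ _} {us′ = _ ∷ _}  eq   (_ ∷ pu) nv       (_ ∷ pu′)  nv′
  with refl , eq′ ← List.∷-injective eq
  with refl , refl ← ++-split-unique eq′ pu nv pu′ nv′ = refl , refl

concatMap-⊆ : ∀ {f g : A → List C} → (∀ a → f a ⊆ g a) → ∀ as → concatMap f as ⊆ concatMap g as
concatMap-⊆ h []       = []
concatMap-⊆ h (a ∷ as) = Sub.++⁺ (h a) (concatMap-⊆ h as)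

length-filter-¬ : ∀ {P : Pred A 0ℓ} (P? : Decidable P) xs →
                  length (filter P? xs) + length (filter (¬? ∘ P?) xs) ≡ length xs
length-filter-¬ P? []       = refl
length-filter-¬ P? (x ∷ xs) with P? x
... | yes _ = cong suc (length-filter-¬ P? xs)
... | no  _ = trans (ℕ.+-suc _ _) (cong suc (length-filter-¬ P? xs))

∈-subsequences⁺ : xs ⊆ ys → xs ∈ subsequences ys
∈-subsequences⁺ []         = here refl
∈-subsequences⁺ (_ ∷ʳ τ)   = ∈-++⁺ʳ _ (∈-subsequences⁺ τ)
∈-subsequences⁺ (refl ∷ τ) = ∈-++⁺ˡ (∈-map⁺ _ (∈-subsequences⁺ τ))

∈-subsequences⁻ : ∀ ys → xs ∈ subsequences ys → xs ⊆ ys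
∈-subsequences⁻ []       (here refl) = []
∈-subsequences⁻ (y ∷ ys) i with ∈-++⁻ (map (y ∷_) (subsequences ys)) i
... | inj₂ j = y ∷ʳ ∈-subsequences⁻ ys j
... | inj₁ j with _ , k , refl ← ∈-map⁻ (y ∷_) j = refl ∷ ∈-subsequences⁻ ys k

filter-map : ∀ {P : Pred C 0ℓ} (P? : Decidable P) (f : A → C) xs →
             filter P? (map f xs) ≡ map f (filter (P? ∘ f) xs)
filter-map P? f []       = refl
filter-map P? f (x ∷ xs) with does (P? (f x))
... | true  = cong (f x ∷_) (filter-map P? f xs)
... | false = filter-map P? f xs

filter-concatMap : ∀ {P : Pred C 0ℓ} (P? : Decidable P) (f : A → List C) xs →
                   filter P? (concatMap f xs) ≡ concatMap (filter P? ∘ f) xs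
filter-concatMap P? f []       = refl
filter-concatMap P? f (x ∷ xs) =
  trans (List.filter-++ P? (f x) (concatMap f xs)) (cong (filter P? (f x) ++_) (filter-concatMap P? f xs))

length-concatMap : ∀ (f : A → List C) xs → length (concatMap f xs) ≡ sum (map (length ∘ f) xs)
length-concatMap f []       = refl
length-concatMap f (x ∷ xs) =
  trans (List.length-++ (f x)) (cong (_+_ (length (f x))) (length-concatMap f xs))

-- Kept general in `R`: with inequality it makes concatenations duplicate-free, and with `Sorted` it
-- describes the order of the labels in `α₁` and `α₂`.
AllPairs-concatMap : ∀ {R : Rel C 0ℓ} (g : A → List C) → (∀ i → AllPairs R (g i)) →
                     (∀ {i j s t} → i ≢ j → s ∈ g i → t ∈ g j → R s t) →
                     ∀ {is} → Unique is → AllPairs R (concatMap g is)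
AllPairs-concatMap g within across u = AllPairs.concat⁺ (All.map⁺ (All.universal within _))
  (AllPairs.map⁺ (AllPairs.map (λ i≢j → All.tabulate λ s∈ → All.tabulate λ t∈ → across i≢j s∈ t∈) u))

-- b is the intersection of xs and ys, U their union.
inclusion-exclusion : DecidableEquality A → ∀ {xs ys : List A} → Unique xs → Unique ys →
  ∃₂ λ b U → length xs + length ys ≡ length b + length U × Unique U
           × (∀ {s} → s ∈ U → s ∈ xs ⊎ s ∈ ys) × b ⊆ xs × (∀ {s} → s ∈ b → s ∈ ys)
inclusion-exclusion _≟_ {xs} {ys} ux uy =
  b , r ++ ys , count
  , Unique.++⁺ (Unique.filter⁺ (¬? ∘ (_∈? ys)) ux) uy
      (λ { (i , j) → proj₂ (∈-filter⁻ (¬? ∘ (_∈? ys)) {xs = xs} i) j })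
  , from , Sub.filter-⊆ (_∈? ys) xs , λ i → proj₂ (∈-filter⁻ (_∈? ys) {xs = xs} i)
  where
  open DecMembership _≟_ using (_∈?_)
  b = filter (_∈? ys) xs
  r = filter (¬? ∘ (_∈? ys)) xs
  count : length xs + length ys ≡ length b + length (r ++ ys)
  count = trans (cong (_+ length ys) (sym (length-filter-¬ (_∈? ys) xs)))
          (trans (ℕ.+-assoc (length b) (length r) (length ys))
            (cong (_+_ (length b)) (sym (List.length-++ r))))
  from : ∀ {s} → s ∈ r ++ ys → s ∈ xs ⊎ s ∈ ys
  from i with ∈-++⁻ r i
  ... | inj₁ j = inj₁ (proj₁ (∈-filter⁻ (¬? ∘ (_∈? ys)) {xs = xs} j))
  ... | inj₂ j = inj₂ j

common⊎disjoint : DecidableEquality A → ∀ (xs ys : List A) → (∃ λ s → s ∈ xs × s ∈ ys) ⊎ Disjoint xs ys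
common⊎disjoint _≟_ xs ys with Any.any? (λ s → DecMembership._∈?_ _≟_ s ys) xs
... | yes i = inj₁ (find i)
... | no ¬i = inj₂ λ { (i , j) → ¬i (lose i j) }

-- Extremal characterisations of LCS and the median optimum

module _ {k} (Γ : Alphabet k) where
  open DecSublist (Alphabet._≟_ Γ) using (_⊆?_)
  private enum = Alphabet.enum Γ

  LCS-upper : ∀ {w} x y → w ⊆ x → w ⊆ y → length w ℕ.≤ LCS Γ x y
  LCS-upper x y τ υ = All.lookup (xs≤max 0 (map length (filter (_⊆? y) (subsequences x))))
    (∈-map⁺ length (∈-filter⁺ (_⊆? y) (∈-subsequences⁺ τ) υ))

  LCS-witness : ∀ x y → ∃ λ w → w ⊆ x × w ⊆ y × length w ≡ LCS Γ x y
  LCS-witness x y with argmax-sel (λ n → n) 0 (map length (filter (_⊆? y) (subsequences x)))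
  -- When the maximum is the default `0`, the empty word realises it.
  ... | inj₁ eq = [] , minimum x , minimum y , sym eq
  ... | inj₂ i with w , j , eq ← ∈-map⁻ length i
      with j₁ , j₂ ← ∈-filter⁻ (_⊆? y) {xs = subsequences x} j =
    w , ∈-subsequences⁻ x j₁ , j₂ , sym eq

  ∈-symbols : ∀ s → s ∈ symbols Γ
  ∈-symbols s = subst (_∈ symbols Γ) (Inverse.strictlyInverseʳ enum s)
    (∈-map⁺ (Inverse.from enum) (∈-allFin (Inverse.to enum s)))

  length-symbols : length (symbols Γ) ≡ k
  length-symbols = trans (List.length-map (Inverse.from enum) (allFin k)) (List.length-tabulate (λ i → i))

  symbols-IsPermutation : IsPermutation Γ (symbols Γ)
  symbols-IsPermutation =
    Unique.map⁺ (λ {i} {j} eq → trans (sym (Inverse.strictlyInverseˡ enum i))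
                  (trans (cong (Inverse.to enum) eq) (Inverse.strictlyInverseˡ enum j)))
      (Unique.allFin⁺ k)
    , ∈-symbols

  length-Unique-≤ : ∀ {w} → Unique w → length w ℕ.≤ k
  length-Unique-≤ u = ℕ.≤-trans (length-≤-Unique u (λ {a} _ → ∈-symbols a)) (ℕ.≤-reflexive length-symbols)

  length-IsPermutation : ∀ {w} → IsPermutation Γ w → length w ≡ k
  length-IsPermutation (u , c) = ℕ.≤-antisym (length-Unique-≤ u)
    (ℕ.≤-trans (ℕ.≤-reflexive (sym length-symbols))
      (length-≤-Unique (proj₁ symbols-IsPermutation) (λ {a} _ → c a)))

  ∈-words : ∀ w → w ∈ words Γ (length w)
  ∈-words []      = here refl
  ∈-words (s ∷ w) = ∈-concatMap⁺ _ (Any.map (λ {refl → ∈-map⁺ (_∷ w) (∈-symbols s)}) (∈-words w))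

  ∈-permutations : ∀ {w} → IsPermutation Γ w → w ∈ permutations Γ
  ∈-permutations {w} p = ∈-filter⁺ (isPermutation? Γ)
    (subst (λ l → w ∈ words Γ l) (length-IsPermutation p) (∈-words w)) p

  OPTmed-≤ : ∀ Π {w} → IsPermutation Γ w → OPTmed Γ Π ℕ.≤ medianCost Γ Π w
  OPTmed-≤ Π p = min≤v⁺ _ _
    (inj₂ (Any.map⁺ (Any.map (λ {refl → ℕ.≤-refl}) (∈-permutations p))))

  ≤-OPTmed : ∀ Π {v} → (∀ {w} → IsPermutation Γ w → v ℕ.≤ medianCost Γ Π w) → v ℕ.≤ OPTmed Γ Π
  -- The default of the minimum is the cost of `symbols Γ`, which `h` bounds as well since
  -- `symbols Γ` is a permutation.
  ≤-OPTmed Π h = v≤min⁺ (h symbols-IsPermutation)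
    (All.map⁺ (All.tabulate λ i → h (proj₂ (∈-filter⁻ (isPermutation? Γ) {xs = words Γ k} i))))

-- Words over a disjoint union of alphabets

module _ {m k} (Γ : Fin m → Alphabet k) where

  tag : ∀ j → Symbol (Γ j) → Symbol (⨁ Γ)
  tag j s = j , s

  -- The tagging matches the construction of the instance, so `β₁ G` and `β₂ G` are by definition
  -- the joins of all `Gadget.P` and of all `Gadget.P′`.
  join : (∀ j → List (Symbol (Γ j))) → List (Fin m) → List (Symbol (⨁ Γ))
  join F = concatMap (λ j → map (tag j) (F j))

  ∈-join⁺ : ∀ {F js j s} → j ∈ js → s ∈ F j → (j , s) ∈ join F js
  ∈-join⁺ j∈ s∈ = ∈-concatMap⁺ _ (lose j∈ (∈-map⁺ (tag _) s∈))

  ∈-join⁻ : ∀ {F} js {j s} → (j , s) ∈ join F js → j ∈ js × s ∈ F j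
  ∈-join⁻ {F} js i with _ , j∈ , i′ ← find (∈-concatMap⁻ (λ j → map (tag j) (F j)) {xs = js} i)
                  with _ , s∈ , refl ← ∈-map⁻ (tag _) i′ = j∈ , s∈

  tag-map : ∀ {j} (F : List (Symbol (Γ j))) → All {A = Symbol (⨁ Γ)} (λ s → proj₁ s ≡ j) (map (tag j) F)
  tag-map F = All.map⁺ (All.universal (λ _ → refl) F)

  join-Unique : ∀ {F js} → (∀ j → Unique (F j)) → Unique js → Unique (join F js)
  join-Unique uF = AllPairs-concatMap _ (λ j → Unique.map⁺ (λ { refl → refl }) (uF j))
    (λ { i≢j s∈ t∈ refl → i≢j (trans (sym (All.lookup (tag-map _) s∈)) (All.lookup (tag-map _) t∈)) })

  filter-join : ∀ {P : Pred (Symbol (⨁ Γ)) 0ℓ} (P? : Decidable P) F js →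
                filter P? (join F js) ≡ join (λ j → filter (P? ∘ tag j) (F j)) js
  filter-join P? F js = trans (filter-concatMap P? _ js)
    (List.concatMap-cong (λ j → filter-map P? (tag j) (F j)) js)

  LCS-sum : (F F′ : ∀ j → List (Symbol (Γ j))) → List (Fin m) → ℕ
  LCS-sum F F′ js = sum (map (λ j → LCS (Γ j) (F j) (F′ j)) js)

  -- Longest common subsequences of the components are concatenated. By `join-upper` nothing longer
  -- exists, so the LCS is additive over components listed in the same order.
  join-witness : ∀ F F′ js → ∃ λ w → w ⊆ join F js × w ⊆ join F′ js × length w ≡ LCS-sum F F′ js
  join-witness F F′ []       = [] , [] , [] , refl
  join-witness F F′ (j ∷ js)
    with u , τ , υ , eq ← LCS-witness (Γ j) (F j) (F′ j)
    with w , τ′ , υ′ , eq′ ← join-witness F F′ js =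
    map (tag j) u ++ w , Sub.++⁺ (Sub.map⁺ (tag j) τ) τ′ , Sub.++⁺ (Sub.map⁺ (tag j) υ) υ′ ,
    trans (List.length-++ (map (tag j) u)) (cong₂ _+_ (trans (List.length-map (tag j) u) eq) eq′)

  tag-join : ∀ {j js F w} → All (j ≢_) js → w ⊆ join F js → All (λ s → ¬ (proj₁ s ≡ j)) w
  tag-join {js = js} j∉ τ =
    All.tabulate λ i eq → All.lookup j∉ (proj₁ (∈-join⁻ js (lookup τ i))) (sym eq)

  -- A common subsequence is cut after component `j` twice, once as a sublist of each join. Symbols
  -- before either cut carry the tag `j`, and those after it do not because `j` is absent from `js`;
  -- by `++-split-unique` the two cuts coincide, and each component is bounded by its own LCS.
  join-upper : ∀ F F′ {js w} → Unique js → w ⊆ join F js → w ⊆ join F′ js → length w ℕ.≤ LCS-sum F F′ js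
  join-upper F F′ [] [] [] = z≤n
  join-upper F F′ {j ∷ js} (j∉ ∷ u) τ υ
    with _ , v , refl , τ₁ , τ₂ ← ⊆-++⁻ (map (tag j) (F j)) τ
    with a , refl , τ₃ ← ⊆-map⁻ (tag j) (F j) τ₁
    with _ , v′ , eq , υ₁ , υ₂ ← ⊆-++⁻ (map (tag j) (F′ j)) υ
    with a′ , refl , υ₃ ← ⊆-map⁻ (tag j) (F′ j) υ₁
    with eq₁ , refl ← ++-split-unique {P = λ (s : Symbol (⨁ Γ)) → proj₁ s ≡ j} eq (tag-map a) (tag-join j∉ τ₂) (tag-map a′) (tag-join j∉ υ₂) =
    ℕ.≤-trans (ℕ.≤-reflexive (trans (List.length-++ (map (tag j) a)) (cong (_+ length v) (List.length-map (tag j) a))))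
      (ℕ.+-mono-≤ (LCS-upper (Γ j) (F j) (F′ j) τ₃ (subst (_⊆ F′ j) (sym (List.map-injective (λ { refl → refl }) eq₁)) υ₃))
                  (join-upper F F′ u τ₂ υ₂))

-- Arithmetic of the lower bound

private
  straighten : ∀ a b c d → (a + b) + (c + d) ≡ (a + c) + (b + d)
  straighten = solve-∀

  cross : ∀ a b c d → (a + b) + (c + d) ≡ (a + d) + (b + c)
  cross = solve-∀

  -- The choice `M = 2N + 1` enters here. An overlapping pair contributes at most `2N + M` and the
  -- other pair at most `N + 2M`; the sum `3N + 3M` equals `4M + N - 1`, which is below the target
  -- for every `r`.
  overlapping-total : ∀ N M t r → M ≡ 2 *ℕ N + 1 → t ℕ.≤ ((N + N) + M) + (N + (M + M)) → t ℕ.≤ 4 *ℕ M + (N + r)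
  overlapping-total N M t r refl le = begin
    t                                        ≤⟨ le ⟩
    ((N + N) + M) + (N + (M + M))            ≤⟨ ℕ.m≤m+n _ 1 ⟩
    ((N + N) + M) + (N + (M + M)) + 1        ≡⟨ regroup N ⟩
    4 *ℕ M + N                               ≤⟨ ℕ.+-monoʳ-≤ (4 *ℕ M) (ℕ.m≤m+n N r) ⟩
    4 *ℕ M + (N + r)                         ∎
    where
    open ℕ.≤-Reasoning
    regroup : ∀ N → ((N + N) + (2 *ℕ N + 1)) + (N + ((2 *ℕ N + 1) + (2 *ℕ N + 1))) + 1 ≡ 4 *ℕ (2 *ℕ N + 1) + N
    regroup = solve-∀

  disjoint-total : ∀ M r b₁ b₂ a₁ a₂ {c₁ c₂ d₁ d₂} → c₁ ℕ.≤ M → c₂ ℕ.≤ M → d₁ ℕ.≤ M → d₂ ℕ.≤ M →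
                   (b₁ + b₂) + (a₁ + a₂) ℕ.≤ r → ((b₁ + c₁) + (b₂ + c₂)) + ((a₁ + d₁) + (a₂ + d₂)) ℕ.≤ 4 *ℕ M + r
  disjoint-total M r b₁ b₂ a₁ a₂ {c₁} {c₂} {d₁} {d₂} p₁ p₂ q₁ q₂ le = begin
    ((b₁ + c₁) + (b₂ + c₂)) + ((a₁ + d₁) + (a₂ + d₂))  ≡⟨ regroup b₁ c₁ b₂ c₂ a₁ d₁ a₂ d₂ ⟩
    ((c₁ + c₂) + (d₁ + d₂)) + ((b₁ + b₂) + (a₁ + a₂))  ≤⟨ ℕ.+-mono-≤ (ℕ.+-mono-≤ (ℕ.+-mono-≤ p₁ p₂) (ℕ.+-mono-≤ q₁ q₂)) le ⟩
    ((M + M) + (M + M)) + r                            ≡⟨ cong (_+ r) (four M) ⟩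
    4 *ℕ M + r                                         ∎
    where
    open ℕ.≤-Reasoning
    regroup : ∀ b₁ c₁ b₂ c₂ a₁ d₁ a₂ d₂ → ((b₁ + c₁) + (b₂ + c₂)) + ((a₁ + d₁) + (a₂ + d₂))
                ≡ ((c₁ + c₂) + (d₁ + d₂)) + ((b₁ + b₂) + (a₁ + a₂))
    regroup = solve-∀
    four : ∀ x → (x + x) + (x + x) ≡ 4 *ℕ x
    four = solve-∀

  -- The four distances sum to at least `4K` minus the total, and
  -- `4(N + M) - 4M - N - h = 3N - h = 5h`. Of truncated subtraction only `K ≤ x + (K ∸ x)` is used,
  -- which holds for every `x`.
  total-to-cost : ∀ N M h t x₁ x₂ x₃ x₄ → N ≡ h + h → (x₁ + x₂) + (x₃ + x₄) ℕ.≤ 4 *ℕ M + (N + (h + t)) →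
                  let K = N + M in 5 *ℕ h ℕ.≤ ((K ∸ x₁) + ((K ∸ x₂) + ((K ∸ x₃) + ((K ∸ x₄) + 0)))) + t
  total-to-cost N M h t x₁ x₂ x₃ x₄ refl le = ℕ.+-cancelˡ-≤ (4 *ℕ M + (N + h)) (5 *ℕ h) (c + t) (begin
    (4 *ℕ M + (N + h)) + 5 *ℕ h             ≡⟨ expand M h ⟩
    (K + K) + (K + K)
      ≤⟨ ℕ.+-mono-≤ (ℕ.+-mono-≤ (ℕ.m≤n+m∸n K x₁) (ℕ.m≤n+m∸n K x₂)) (ℕ.+-mono-≤ (ℕ.m≤n+m∸n K x₃) (ℕ.m≤n+m∸n K x₄)) ⟩
    ((x₁ + (K ∸ x₁)) + (x₂ + (K ∸ x₂))) + ((x₃ + (K ∸ x₃)) + (x₄ + (K ∸ x₄)))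
      ≡⟨ collect x₁ x₂ x₃ x₄ (K ∸ x₁) (K ∸ x₂) (K ∸ x₃) (K ∸ x₄) ⟩
    ((x₁ + x₂) + (x₃ + x₄)) + c            ≤⟨ ℕ.+-monoˡ-≤ c le ⟩
    (4 *ℕ M + (N + (h + t))) + c           ≡⟨ move M N h t c ⟩
    (4 *ℕ M + (N + h)) + (c + t)           ∎)
    where
    open ℕ.≤-Reasoning
    K = N + M
    c = (K ∸ x₁) + ((K ∸ x₂) + ((K ∸ x₃) + ((K ∸ x₄) + 0)))
    expand : ∀ M h → (4 *ℕ M + ((h + h) + h)) + 5 *ℕ h ≡ (((h + h) + M) + ((h + h) + M)) + (((h + h) + M) + ((h + h) + M))
    expand = solve-∀
    collect : ∀ x₁ x₂ x₃ x₄ y₁ y₂ y₃ y₄ → ((x₁ + y₁) + (x₂ + y₂)) + ((x₃ + y₃) + (x₄ + y₄))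
                ≡ ((x₁ + x₂) + (x₃ + x₄)) + (y₁ + (y₂ + (y₃ + (y₄ + 0))))
    collect = solve-∀
    move : ∀ M N h t c → (4 *ℕ M + (N + (h + t))) + c ≡ (4 *ℕ M + (N + h)) + (c + t)
    move = solve-∀

-- Symbols agreeing with an assignment

module _ {n m B : ℕ} (φ : CSP n m) (G : Gadgets φ B) where
  private
    Ω = Σ-alphabet G
    S = Symbol Ω
    Θ = medianAlphabet G
    Γ = λ j → Gadget.alphabet (G j)
    N = m *ℕ B
    Mᴳ = M G

  Agrees : (Fin n → Bool) → Pred S 0ℓ
  Agrees f s = f (varΣ G s) ≡ labelΣ G s

  agrees? : ∀ f → Decidable (Agrees f)
  agrees? f s = f (varΣ G s) Bool.≟ labelΣ G s

  module _ (f : Fin n → Bool) where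

    agreeing agreeing′ : ∀ j → List (Symbol (Γ j))
    agreeing  j = filter (Gadget.Agr? (G j) (f ∘ proj₁)) (Gadget.P  (G j))
    agreeing′ j = filter (Gadget.Agr? (G j) (f ∘ proj₁)) (Gadget.P′ (G j))

    -- By `score-upper` and `score-witness` this is the length of a longest common subsequence of
    -- `β₁` and `β₂` among the symbols that agree with `f`; `score-value` expresses it through
    -- `Val φ f`.
    score : ℕ
    score = LCS-sum Γ agreeing agreeing′ (allFin m)

    agreeing-word : List S
    agreeing-word = join Γ agreeing (allFin m)

    agreeing-word-Unique : Unique agreeing-word
    agreeing-word-Unique = join-Unique Γ
      (λ j → Unique.filter⁺ (Gadget.Agr? (G j) (f ∘ proj₁)) (proj₁ (Gadget.P-perm (G j)))) (Unique.allFin⁺ m)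

    ∈-agreeing-word⁺ : ∀ s → Agrees f s → s ∈ agreeing-word
    ∈-agreeing-word⁺ (j , s) eq = ∈-join⁺ Γ (∈-allFin j)
      (∈-filter⁺ (Gadget.Agr? (G j) (f ∘ proj₁)) (proj₂ (Gadget.P-perm (G j)) s) eq)

    ∈-agreeing-word⁻ : ∀ {s} → s ∈ agreeing-word → Agrees f s
    ∈-agreeing-word⁻ {j , s} i =
      proj₂ (∈-filter⁻ (Gadget.Agr? (G j) (f ∘ proj₁)) {xs = Gadget.P (G j)} (proj₂ (∈-join⁻ Γ (allFin m) i)))

    filter-β₁ : filter (agrees? f) (β₁ G) ≡ agreeing-word
    filter-β₁ = filter-join Γ (agrees? f) (Gadget.P ∘ G) (allFin m)

    filter-β₂ : filter (agrees? f) (β₂ G) ≡ join Γ agreeing′ (allFin m)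
    filter-β₂ = filter-join Γ (agrees? f) (Gadget.P′ ∘ G) (allFin m)

    -- Filtering by agreement fixes `w` and turns `β₁` and `β₂` into joins of agreeing parts, to
    -- which `join-upper` applies.
    score-upper : ∀ {w} → w ⊆ β₁ G → w ⊆ β₂ G → All (Agrees f) w → length w ℕ.≤ score
    score-upper {w} τ υ ps = join-upper Γ agreeing agreeing′ (Unique.allFin⁺ m)
      (restrict filter-β₁ τ) (restrict filter-β₂ υ)
      where
      restrict : ∀ {β w′} → filter (agrees? f) β ≡ w′ → w ⊆ β → w ⊆ w′
      restrict refl τ = subst (_⊆ _) (List.filter-all (agrees? f) ps)
        (Sub.filter⁺ (agrees? f) (agrees? f) (λ { refl p → p }) τ)

    -- The first inclusion is into `agreeing-word` rather than `β₁ G`, because the word is to be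
    -- found at the front of `median`.
    score-witness : ∃ λ w → w ⊆ agreeing-word × w ⊆ β₂ G × length w ≡ score
    score-witness with w , τ , υ , eq ← join-witness Γ agreeing agreeing′ (allFin m) =
      w , τ , ⊆-trans υ (subst (_⊆ β₂ G) filter-β₂ (Sub.filter-⊆ (agrees? f) (β₂ G))) , eq

    agreeing-word-⊆ : agreeing-word ⊆ β₁ G
    agreeing-word-⊆ = subst (_⊆ β₁ G) filter-β₁ (Sub.filter-⊆ (agrees? f) (β₁ G))

  -- Blocks and symbols disagreeing with an assignment

  module _ (balanced : Balanced G) (O : BlockOrder G) where
    open BlockOrder O

    -- Counts the symbols labelled `false`; by balance, any choice of one block per variable
    -- contains this many symbols.
    half : ℕ
    half = sum (map (λ x → blockSize G x false) (allFin n))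

    length-block : ∀ x b → length (block x b) ≡ blockSize G x b
    length-block x b = ℕ.≤-antisym
      (length-≤-Unique (block-unique x b) λ {s} i →
        ∈-filter⁺ (inBlock? G x b) (∈-symbols Ω s) (Equivalence.to (block-lists x b s) i))
      (length-≤-Unique (Unique.filter⁺ (inBlock? G x b) (proj₁ (symbols-IsPermutation Ω))) λ {s} i →
        Equivalence.from (block-lists x b s) (proj₂ (∈-filter⁻ (inBlock? G x b) {xs = symbols Ω} i)))

    block-var : ∀ {x b s} → s ∈ block x b → varΣ G s ≡ x
    block-var i = proj₁ (Equivalence.to (block-lists _ _ _) i)

    block-label : ∀ {x b s} → s ∈ block x b → labelΣ G s ≡ b
    block-label i = proj₂ (Equivalence.to (block-lists _ _ _) i)

    disagreeing-word : (Fin n → Bool) → List S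
    disagreeing-word f = concatMap (λ x → block x (not (f x))) (allFin n)

    disagreeing-word-Unique : ∀ f → Unique (disagreeing-word f)
    disagreeing-word-Unique f = AllPairs-concatMap _ (λ x → block-unique x (not (f x)))
      (λ { i≢j s∈ t∈ refl → i≢j (trans (sym (block-var s∈)) (block-var t∈)) }) (Unique.allFin⁺ n)

    ∈-disagreeing-word⁺ : ∀ f {s} → labelΣ G s ≡ not (f (varΣ G s)) → s ∈ disagreeing-word f
    ∈-disagreeing-word⁺ f eq = ∈-concatMap⁺ (λ x → block x (not (f x)))
      (lose (∈-allFin _) (Equivalence.from (block-lists _ _ _) (refl , eq)))

    ∈-disagreeing-word⁻ : ∀ f {s} → s ∈ disagreeing-word f → labelΣ G s ≡ not (f (varΣ G s))
    ∈-disagreeing-word⁻ f i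
      with x , _ , j ← find (∈-concatMap⁻ (λ x → block x (not (f x))) {xs = allFin n} i)
      with refl ← block-var j = block-label j

    length-disagreeing-word : ∀ f → length (disagreeing-word f) ≡ half
    length-disagreeing-word f = trans (length-concatMap _ (allFin n))
      (cong sum (List.map-cong (λ x → trans (length-block x (not (f x))) (size x (not (f x)))) (allFin n)))
      where
      size : ∀ x b → blockSize G x b ≡ blockSize G x false
      size x false = refl
      -- This is where the global balance condition enters.
      size x true  = sym (balanced x)

    -- A single block is taken from each variable, so the order of its two blocks, in which `α₁` and
    -- `α₂` differ, does not matter.
    disagreeing-word-⊆-α₁ : ∀ f → disagreeing-word f ⊆ α₁ G O
    disagreeing-word-⊆-α₁ f = concatMap-⊆ (λ x → pick x (not (f x))) (allFin n)
      where
      pick : ∀ x b → block x b ⊆ block x false ++ block x true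
      pick x false = Sub.++⁺ʳ _ ⊆-refl
      pick x true  = Sub.++⁺ˡ _ ⊆-refl

    disagreeing-word-⊆-α₂ : ∀ f → disagreeing-word f ⊆ α₂ G O
    disagreeing-word-⊆-α₂ f = concatMap-⊆ (λ x → pick x (not (f x))) (allFin n)
      where
      pick : ∀ x b → block x b ⊆ block x true ++ block x false
      pick x false = Sub.++⁺ˡ _ ⊆-refl
      pick x true  = Sub.++⁺ʳ _ ⊆-refl

    N≡half+half : N ≡ half + half
    N≡half+half = trans (sym (length-IsPermutation Ω (unique , complete)))
      (trans (List.length-++ (disagreeing-word f))
        (cong₂ _+_ (length-disagreeing-word f) (length-disagreeing-word (not ∘ f))))
      where
      f : Fin n → Bool
      -- The symbols disagreeing with an assignment and those disagreeing with its negation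
      -- partition the alphabet; for a constant assignment the label alone decides the side.
      f _ = true
      unique : Unique (disagreeing-word f ++ disagreeing-word (not ∘ f))
      unique = Unique.++⁺ (disagreeing-word-Unique f) (disagreeing-word-Unique (not ∘ f))
        λ { (i , j) → not-¬ refl (trans (sym (∈-disagreeing-word⁻ (not ∘ f) j)) (∈-disagreeing-word⁻ f i)) }
      complete : ∀ s → s ∈ disagreeing-word f ++ disagreeing-word (not ∘ f)
      complete s with labelΣ G s in eq
      ... | false = ∈-++⁺ˡ (∈-disagreeing-word⁺ f eq)
      ... | true  = ∈-++⁺ʳ (disagreeing-word f) (∈-disagreeing-word⁺ (not ∘ f) eq)

    -- The permutation attaining the bound

    module _ (f : Fin n → Bool) where
      private
        X = agreeing-word f
        Y = disagreeing-word f

      X-Y-Disjoint : Disjoint X Y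
      X-Y-Disjoint (i , j) = not-¬ (sym (∈-agreeing-word⁻ f i)) (∈-disagreeing-word⁻ f j)

      X-Y-complete : ∀ s → s ∈ X ⊎ s ∈ Y
      X-Y-complete s with agrees? f s
      ... | yes a = inj₁ (∈-agreeing-word⁺ f s a)
      ... | no ¬a = inj₂ (∈-disagreeing-word⁺ f (Bool.¬-not (¬a ∘ sym)))

      length-agreeing-word : length X ≡ half
      length-agreeing-word = ℕ.+-cancelʳ-≡ half (length X) half (trans
        (trans (cong (_+_ (length X)) (sym (length-disagreeing-word f))) (sym (List.length-++ X)))
        (trans (length-IsPermutation Ω
          (Unique.++⁺ (agreeing-word-Unique f) (disagreeing-word-Unique f) X-Y-Disjoint
          , λ s → Sum.[_,_] {C = λ _ → s ∈ X ++ Y} ∈-++⁺ˡ (∈-++⁺ʳ X) (X-Y-complete s)))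
          N≡half+half))

      median : List (Symbol Θ)
      median = map inj₁ X ++ (Z G ++ map inj₁ Y)

      inj₁∉Z : ∀ {s : S} → inj₁ s ∉ Z G
      inj₁∉Z i with () ← proj₂ (proj₂ (∈-map⁻ inj₂ i))

      median-IsPermutation : IsPermutation Θ median
      median-IsPermutation = unique , complete
        where
        unique : Unique median
        unique = Unique.++⁺ (Unique.map⁺ inj₁-injective (agreeing-word-Unique f))
          (Unique.++⁺ (Unique.map⁺ inj₂-injective (Unique.allFin⁺ Mᴳ))
            (Unique.map⁺ inj₁-injective (disagreeing-word-Unique f))
            λ { (i , j) → dis₁ i j })
          λ { (i , j) → dis₂ i (∈-++⁻ (Z G) j) }
          where
          dis₁ : ∀ {s} → s ∈ Z G → s ∈ map inj₁ Y → ⊥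
          dis₁ i j with _ , _ , refl ← ∈-map⁻ inj₁ j = inj₁∉Z i
          dis₂ : ∀ {s} → s ∈ map inj₁ X → s ∈ Z G ⊎ s ∈ map inj₁ Y → ⊥
          dis₂ i (inj₁ j) with _ , _ , refl ← ∈-map⁻ inj₁ i = inj₁∉Z j
          dis₂ i (inj₂ j) with _ , i′ , refl ← ∈-map⁻ inj₁ i with _ , j′ , refl ← ∈-map⁻ inj₁ j =
            X-Y-Disjoint (i′ , j′)
        complete : ∀ s → s ∈ median
        complete (inj₂ z) = ∈-++⁺ʳ (map inj₁ X) (∈-++⁺ˡ (∈-map⁺ inj₂ (∈-allFin z)))
        complete (inj₁ s) with X-Y-complete s
        ... | inj₁ i = ∈-++⁺ˡ (∈-map⁺ inj₁ i)
        ... | inj₂ i = ∈-++⁺ʳ (map inj₁ X) (∈-++⁺ʳ (Z G) (∈-map⁺ inj₁ i))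

      length-Z : length (Z G) ≡ Mᴳ
      length-Z = trans (List.length-map inj₂ (allFin Mᴳ)) (List.length-tabulate (λ i → i))

      -- The common subsequence is `w` followed by all of `Z`; in `right-LCS` it is all of `Z`
      -- followed by all of `Y`.
      left-LCS : ∀ {w β} → w ⊆ X → w ⊆ β → length w + Mᴳ ℕ.≤ LCS Θ median (map inj₁ β ++ Z G)
      left-LCS {w} {β} τ υ = ℕ.≤-trans
        (ℕ.≤-reflexive (sym (trans (List.length-++ (map inj₁ w)) (cong₂ _+_ (List.length-map inj₁ w) length-Z))))
        (LCS-upper Θ median (map inj₁ β ++ Z G)
          (Sub.++⁺ (Sub.map⁺ inj₁ τ) (Sub.++⁺ʳ (map inj₁ Y) ⊆-refl)) (Sub.++⁺ (Sub.map⁺ inj₁ υ) ⊆-refl))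

      right-LCS : ∀ {α} → Y ⊆ α → half + Mᴳ ℕ.≤ LCS Θ median (Z G ++ map inj₁ α)
      right-LCS {α} υ = ℕ.≤-trans
        (ℕ.≤-reflexive (sym (trans (List.length-++ (Z G)) (trans (cong₂ _+_ length-Z
          (trans (List.length-map inj₁ Y) (length-disagreeing-word f))) (ℕ.+-comm Mᴳ half)))))
        (LCS-upper Θ median (Z G ++ map inj₁ α)
          (Sub.++⁺ˡ (map inj₁ X) ⊆-refl) (Sub.++⁺ ⊆-refl (Sub.map⁺ inj₁ υ)))

      -- Besides `Z`, `L₁` matches the whole agreeing half, `L₂` matches `score f` symbols of it,
      -- and `R₁` and `R₂` match the whole disagreeing half. The distances are thus at most `half`,
      -- `2 half - score f`, `half` and `half`.
      median-cost : medianCost Θ (Π[_] G O) median + score f ℕ.≤ 5 *ℕ half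
      median-cost with w , τ , υ , eq ← score-witness f = begin
        medianCost Θ (Π[_] G O) median + score f
          ≤⟨ ℕ.+-monoˡ-≤ (score f) (ℕ.+-mono-≤ c₁ (ℕ.+-mono-≤ c₂ (ℕ.+-mono-≤ c₃ (ℕ.+-mono-≤ c₄ z≤n)))) ⟩
        (half + (r + (half + (half + 0)))) + score f
          ≡⟨ lemma half r (score f) ⟩
        3 *ℕ half + (r + score f)
          ≡⟨ cong (_+_ (3 *ℕ half)) (ℕ.m∸n+n≡m score≤) ⟩
        3 *ℕ half + (half + half)
          ≡⟨ lemma′ half ⟩
        5 *ℕ half ∎
        where
        open ℕ.≤-Reasoning
        r = (half + half) ∸ score f
        lemma : ∀ h r t → (h + (r + (h + (h + 0)))) + t ≡ 3 *ℕ h + (r + t)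
        lemma = solve-∀
        lemma′ : ∀ h → 3 *ℕ h + (h + h) ≡ 5 *ℕ h
        lemma′ = solve-∀
        -- Keeps the subtraction in `r` from truncating.
        score≤ : score f ℕ.≤ half + half
        score≤ = ℕ.≤-trans (ℕ.≤-reflexive (sym eq)) (ℕ.≤-trans (Sub.length-mono-≤ τ)
          (ℕ.≤-trans (ℕ.≤-reflexive length-agreeing-word) (ℕ.m≤m+n half half)))
        bound : ∀ {l L r} → l + Mᴳ ℕ.≤ L → r + l ≡ half + half → (N + Mᴳ) ∸ L ℕ.≤ r
        bound {l} {L} {r} l≤L e = ℕ.m≤n+o⇒m∸n≤o (N + Mᴳ) L (begin
          N + Mᴳ        ≡⟨ cong (_+ Mᴳ) (trans N≡half+half (trans (sym e) (ℕ.+-comm r l))) ⟩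
          (l + r) + Mᴳ  ≡⟨ swap l r Mᴳ ⟩
          (l + Mᴳ) + r  ≤⟨ ℕ.+-monoˡ-≤ r l≤L ⟩
          L + r         ∎)
          where
          swap : ∀ l r M → (l + r) + M ≡ (l + M) + r
          swap = solve-∀
        c₁ : ulam Θ median (L₁ G) ℕ.≤ half
        c₁ = bound (left-LCS ⊆-refl (agreeing-word-⊆ f)) (cong (_+_ half) length-agreeing-word)
        c₂ : ulam Θ median (L₂ G) ℕ.≤ r
        c₂ = bound (left-LCS τ υ) (trans (cong (_+_ r) eq) (ℕ.m∸n+n≡m score≤))
        c₃ : ulam Θ median (R₁ G O) ℕ.≤ half
        c₃ = bound (right-LCS (disagreeing-word-⊆-α₁ f)) refl
        c₄ : ulam Θ median (R₂ G O) ℕ.≤ half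
        c₄ = bound (right-LCS (disagreeing-word-⊆-α₂ f)) refl

    -- Common subsequences of `α₁` and `α₂`

    -- Within the symbols of one variable, label b cannot precede label not b.
    Sorted : Bool → Rel S 0ℓ
    Sorted b s t = varΣ G s ≡ varΣ G t → labelΣ G s ≡ b → labelΣ G t ≡ b

    SameLabel : Rel S 0ℓ
    SameLabel s t = varΣ G s ≡ varΣ G t → labelΣ G s ≡ labelΣ G t

    -- For `b = true` this list is `α₁ G O`, and for `b = false` it is `α₂ G O`. Symbols of
    -- different variables satisfy the relation vacuously.
    blocks-Sorted : ∀ b → AllPairs (Sorted b) (concatMap (λ x → block x (not b) ++ block x b) (allFin n))
    blocks-Sorted b = AllPairs-concatMap _
      (λ x → AllPairs.++⁺
        (AllPairs-universal λ i j _ l → ⊥-elim (not-¬ l (block-label i)))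
        (AllPairs-universal λ i j _ l → block-label j)
        (All.tabulate λ i → All.tabulate λ j _ l → block-label j))
      (λ i≢j s∈ t∈ eq → ⊥-elim (i≢j (trans (sym (var s∈)) (trans eq (var t∈)))))
      (Unique.allFin⁺ n)
      where
      var : ∀ {x s} → s ∈ block x (not b) ++ block x b → varΣ G s ≡ x
      var {x} i with ∈-++⁻ (block x (not b)) i
      ... | inj₁ j = block-var j
      ... | inj₂ j = block-var j
      AllPairs-universal : ∀ {R : Rel S 0ℓ} {xs} → (∀ {s t} → s ∈ xs → t ∈ xs → R s t) → AllPairs R xs
      AllPairs-universal {xs = []}     h = []
      AllPairs-universal {xs = x ∷ xs} h =
        All.tabulate (λ i → h (here refl) (there i)) ∷ AllPairs-universal (λ i j → h (there i) (there j))

    -- If `s` comes before `t` in `a` and both have the same variable, the label of `s` selects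
    -- which of the two sortedness conditions forces that label on `t`.
    common-SameLabel : ∀ {a s t} → a ⊆ α₁ G O → a ⊆ α₂ G O → s ∈ a → t ∈ a → SameLabel s t
    common-SameLabel τ υ = AllPairs-lookup {R = SameLabel} (λ _ → refl) (λ h e → sym (h (sym e)))
      (AllPairs.zipWith merge
        (AllPairs-resp-⊆ τ (blocks-Sorted true) , AllPairs-resp-⊆ υ (blocks-Sorted false)))
      where
      merge : ∀ {s t} → Sorted true s t × Sorted false s t → SameLabel s t
      merge {s} (h , h′) e with labelΣ G s
      ... | true  = sym (h e refl)
      ... | false = sym (h′ e refl)

    common-assignment : ∀ {a} → a ⊆ α₁ G O → a ⊆ α₂ G O →
                        ∃ λ f → ∀ {s} → s ∈ a → labelΣ G s ≡ not (f (varΣ G s))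
    -- The assignment is made opposite to `a`: `f x` is `false` exactly when a symbol of `x`
    -- labelled `true` occurs in `a`. Variables missing from `a` get `true`.
    common-assignment {a} τ υ = (λ x → not (does (true? x))) , λ {s} i → trans (label i) (sym (not-involutive _))
      where
      true? : ∀ x → Dec _
      true? x = Any.any? (inBlock? G x true) a
      label : ∀ {s} → s ∈ a → labelΣ G s ≡ does (true? (varΣ G s))
      label {s} i with true? (varΣ G s)
      ... | yes p with t , j , v , l ← find p = trans (common-SameLabel τ υ i j (sym v)) l
      ... | no ¬p = Bool.¬-not (λ l → ¬p (lose i (refl , l)))

    -- The assignment is chosen so that all of `a` disagrees with it. The symbols of `b` that agree
    -- are bounded by the score; the others, being disjoint from `a`, fit together with `a` into
    -- `disagreeing-word f`.
    disjoint-bound : ∀ {b a} → b ⊆ β₁ G → b ⊆ β₂ G → a ⊆ α₁ G O → a ⊆ α₂ G O → Unique b → Unique a → Disjoint b a →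
                     ∃ λ f → length b + length a ℕ.≤ half + score f
    disjoint-bound {b} {a} τ₁ τ₂ υ₁ υ₂ ub ua dis with f , lab ← common-assignment υ₁ υ₂ = f , (begin
      length b + length a
        ≡⟨ cong (_+ length a) (sym (length-filter-¬ (agrees? f) b)) ⟩
      (length b⁺ + length b⁻) + length a
        ≡⟨ ℕ.+-assoc (length b⁺) (length b⁻) (length a) ⟩
      length b⁺ + (length b⁻ + length a)
        ≤⟨ ℕ.+-mono-≤ agree disagree ⟩
      score f + half
        ≡⟨ ℕ.+-comm (score f) half ⟩
      half + score f ∎)
      where
      open ℕ.≤-Reasoning
      b⁺ = filter (agrees? f) b
      b⁻ = filter (¬? ∘ agrees? f) b
      agree : length b⁺ ℕ.≤ score f
      agree = score-upper f (⊆-trans (Sub.filter-⊆ (agrees? f) b) τ₁)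
        (⊆-trans (Sub.filter-⊆ (agrees? f) b) τ₂) (All.all-filter (agrees? f) b)
      b⁻∈ : ∀ {s} → s ∈ b⁻ → s ∈ b × ¬ Agrees f s
      b⁻∈ = ∈-filter⁻ (¬? ∘ agrees? f) {xs = b}
      inc : ∀ {s} → s ∈ b⁻ ++ a → s ∈ disagreeing-word f
      inc i with ∈-++⁻ b⁻ i
      ... | inj₁ j = ∈-disagreeing-word⁺ f (Bool.¬-not (proj₂ (b⁻∈ j) ∘ sym))
      ... | inj₂ j = ∈-disagreeing-word⁺ f (lab j)
      disagree : length b⁻ + length a ℕ.≤ half
      disagree = begin
        length b⁻ + length a  ≡⟨ sym (List.length-++ b⁻) ⟩
        length (b⁻ ++ a)
          ≤⟨ length-≤-Unique (Unique.++⁺ (Unique.filter⁺ (¬? ∘ agrees? f) ub) ua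
               λ { (i , j) → dis (proj₁ (b⁻∈ i) , j) }) inc ⟩
        length (disagreeing-word f) ≡⟨ length-disagreeing-word f ⟩
        half ∎

    -- Lower bound on the cost of every candidate median

    module _ {σ : List (Symbol Θ)} (uσ : Unique σ) where

      -- A longest common subsequence is cut where `Z` begins, so that its two kinds of symbols can
      -- be counted apart: those of the gadgets against `N`, `half` and `score`, those of `Z`
      -- against `M`.
      record LeftWitness (β : List S) : Set where
        field
          word   : List S
          tail   : List (Fin Mᴳ)
          word-⊆ : word ⊆ β
          all-⊆  : map inj₁ word ++ map inj₂ tail ⊆ σ
          size   : length word + length tail ≡ LCS Θ σ (map inj₁ β ++ Z G)

        word-⊆σ : map inj₁ word ⊆ σ
        word-⊆σ = ⊆-trans (Sub.++⁺ʳ (map inj₂ tail) ⊆-refl) all-⊆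

        word-Unique : Unique word
        word-Unique = Unique.map⁻ (AllPairs-resp-⊆ word-⊆σ uσ)

        tail-≤ : length tail ℕ.≤ Mᴳ
        tail-≤ = length-Unique-≤ (finAlphabet Mᴳ)
          (Unique.map⁻ (AllPairs-resp-⊆ (⊆-trans (Sub.++⁺ˡ (map inj₁ word) ⊆-refl) all-⊆) uσ))

      record RightWitness (α : List S) : Set where
        field
          head   : List (Fin Mᴳ)
          word   : List S
          word-⊆ : word ⊆ α
          all-⊆  : map inj₂ head ++ map inj₁ word ⊆ σ
          size   : length word + length head ≡ LCS Θ σ (Z G ++ map inj₁ α)

        word-⊆σ : map inj₁ word ⊆ σ
        word-⊆σ = ⊆-trans (Sub.++⁺ˡ (map inj₂ head) ⊆-refl) all-⊆

        word-Unique : Unique word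
        word-Unique = Unique.map⁻ (AllPairs-resp-⊆ word-⊆σ uσ)

        head-≤ : length head ℕ.≤ Mᴳ
        head-≤ = length-Unique-≤ (finAlphabet Mᴳ)
          (Unique.map⁻ (AllPairs-resp-⊆ (⊆-trans (Sub.++⁺ʳ (map inj₁ word) ⊆-refl) all-⊆) uσ))

      leftWitness : ∀ β → LeftWitness β
      leftWitness β with w , τ , υ , eq ← LCS-witness Θ σ (map inj₁ β ++ Z G)
                    with u , v , refl , υ₁ , υ₂ ← ⊆-++⁻ (map inj₁ β) υ
                    with b , refl , υ₃ ← ⊆-map⁻ inj₁ β υ₁
                    with c , refl , _ ← ⊆-map⁻ inj₂ (allFin Mᴳ) υ₂ = record
        { word = b ; tail = c ; word-⊆ = υ₃ ; all-⊆ = τ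
        ; size = trans (sym (trans (List.length-++ (map inj₁ b))
                   (cong₂ _+_ (List.length-map inj₁ b) (List.length-map inj₂ c)))) eq }

      rightWitness : ∀ α → RightWitness α
      rightWitness α with w , τ , υ , eq ← LCS-witness Θ σ (Z G ++ map inj₁ α)
                     with u , v , refl , υ₁ , υ₂ ← ⊆-++⁻ (Z G) υ
                     with a , refl , υ₃ ← ⊆-map⁻ inj₁ α υ₂
                     with d , refl , _ ← ⊆-map⁻ inj₂ (allFin Mᴳ) υ₁ = record
        { head = d ; word = a ; word-⊆ = υ₃ ; all-⊆ = τ
        ; size = trans (sym (trans (List.length-++ (map inj₂ d))
                   (trans (cong₂ _+_ (List.length-map inj₂ d) (List.length-map inj₁ a))
                     (ℕ.+-comm (length d) (length a))))) eq }

      module _ {β α} (l : LeftWitness β) (r : RightWitness α) where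
        private
          module l = LeftWitness l
          module r = RightWitness r

        -- In σ, the part of Z matched on the right precedes s, and the part matched on the left follows it.
        crossing : ∀ {s} → s ∈ l.word → s ∈ r.word → length l.tail + length r.head ℕ.≤ Mᴳ
        crossing {s} i j = begin
          length l.tail + length r.head ≡⟨ ℕ.+-comm (length l.tail) (length r.head) ⟩
          length r.head + length l.tail ≡⟨ sym (List.length-++ r.head) ⟩
          length (r.head ++ l.tail)
            ≤⟨ length-Unique-≤ (finAlphabet Mᴳ)
                 (Unique.map⁻ (subst Unique (sym (List.map-++ inj₂ r.head l.tail)) (AllPairs-resp-⊆ both uσ))) ⟩
          Mᴳ ∎
          where
          open ℕ.≤-Reasoning
          both : map inj₂ r.head ++ map inj₂ l.tail ⊆ σ
          both = ⊆-trans (Sub.++⁺ ⊆-refl (inj₁ s ∷ʳ ⊆-refl)) (⊆-Unique-glue (map inj₂ r.head) uσ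
            (⊆-trans (Sub.++⁺ ⊆-refl (from∈ (∈-map⁺ inj₁ j))) r.all-⊆)
            (⊆-trans (Sub.++⁺ (from∈ (∈-map⁺ inj₁ i)) ⊆-refl) l.all-⊆))

        pair : ℕ
        pair = (length l.word + length l.tail) + (length r.word + length r.head)

        private
          swap : ∀ b c a d → (b + c) + (a + d) ≡ (b + a) + (c + d)
          swap = solve-∀

        -- Words sharing a symbol may have length `N` each, but by `crossing` their parts in `Z`
        -- have length at most `M` together. In `disjoint-pair` it is the reverse: the words share
        -- one `N`, and each part in `Z` may reach `M`.
        overlap-pair : ∀ {s} → s ∈ l.word → s ∈ r.word → pair ℕ.≤ (N + N) + Mᴳ
        overlap-pair i j = ℕ.≤-trans (ℕ.≤-reflexive (swap (length l.word) _ _ _))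
          (ℕ.+-mono-≤ (ℕ.+-mono-≤ (length-Unique-≤ Ω l.word-Unique) (length-Unique-≤ Ω r.word-Unique)) (crossing i j))

        disjoint-pair : Disjoint l.word r.word → pair ℕ.≤ N + (Mᴳ + Mᴳ)
        disjoint-pair dis = ℕ.≤-trans (ℕ.≤-reflexive (swap (length l.word) _ _ _))
          (ℕ.+-mono-≤ (ℕ.≤-trans (ℕ.≤-reflexive (sym (List.length-++ l.word)))
              (length-Unique-≤ Ω (Unique.++⁺ l.word-Unique r.word-Unique dis)))
            (ℕ.+-mono-≤ l.tail-≤ r.head-≤))

        -- The bound for disjoint words is the weaker of the two because `N ≤ M`.
        any-pair : pair ℕ.≤ N + (Mᴳ + Mᴳ)
        any-pair with common⊎disjoint (Alphabet._≟_ Ω) l.word r.word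
        ... | inj₂ dis = disjoint-pair dis
        ... | inj₁ (_ , i , j) = ℕ.≤-trans (overlap-pair i j) (begin
            (N + N) + Mᴳ  ≡⟨ ℕ.+-assoc N N Mᴳ ⟩
            N + (N + Mᴳ)  ≤⟨ ℕ.+-monoʳ-≤ N (ℕ.+-monoˡ-≤ Mᴳ (ℕ.≤-trans (ℕ.m≤m+n N (N + 0)) (ℕ.m≤m+n (2 *ℕ N) 1))) ⟩
            N + (Mᴳ + Mᴳ) ∎)
          where open ℕ.≤-Reasoning

      -- Here `b` is the intersection, formed as a sublist of `xs`, and `U` is the union. That `b`
      -- is a sublist of `ys` too follows because both words embed in the duplicate-free `σ`, which
      -- fixes the order.
      common-words : ∀ {xs ys} → map inj₁ xs ⊆ σ → map inj₁ ys ⊆ σ →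
                     ∃₂ λ b U → length xs + length ys ≡ length b + length U × Unique U
                       × (∀ {s : S} → s ∈ U → s ∈ xs ⊎ s ∈ ys) × b ⊆ xs × b ⊆ ys
      common-words {xs} {ys} τ υ
        with b , U , count , uU , inc , b⊆ , b∈ ←
          inclusion-exclusion (Alphabet._≟_ Ω) (Unique.map⁻ (AllPairs-resp-⊆ τ uσ)) (Unique.map⁻ (AllPairs-resp-⊆ υ uσ))
        with us , eq , us⊆ ← ⊆-map⁻ inj₁ ys (⊆-Unique-inclusion uσ (⊆-trans (Sub.map⁺ inj₁ b⊆) τ) υ
               (λ i → let _ , j , e = ∈-map⁻ inj₁ i in subst (_∈ map inj₁ ys) (sym e) (∈-map⁺ inj₁ (b∈ j))))
        with refl ← List.map-injective inj₁-injective eq =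
        b , U , count , uU , inc , b⊆ , us⊆

      module _ (l₁ : LeftWitness (β₁ G)) (l₂ : LeftWitness (β₂ G))
               (r₁ : RightWitness (α₁ G O)) (r₂ : RightWitness (α₂ G O)) where
        private
          module l₁ = LeftWitness l₁
          module l₂ = LeftWitness l₂
          module r₁ = RightWitness r₁
          module r₂ = RightWitness r₂

        -- The unions `U` and `V` of the left and of the right words are disjoint, so they have at
        -- most `N` symbols together; the intersections are left to `disjoint-bound`.
        disjoint-words : Disjoint l₁.word r₁.word → Disjoint l₁.word r₂.word →
                         Disjoint l₂.word r₁.word → Disjoint l₂.word r₂.word →
          ∃ λ f → (length l₁.word + length l₂.word) + (length r₁.word + length r₂.word)
                    ℕ.≤ N + (half + score f)
        disjoint-words d₁₁ d₁₂ d₂₁ d₂₂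
          with b , U , eqb , uU , incU , b₁ , b₂ ← common-words l₁.word-⊆σ l₂.word-⊆σ
          with a , V , eqa , uV , incV , a₁ , a₂ ← common-words r₁.word-⊆σ r₂.word-⊆σ
          with f , le ← disjoint-bound (⊆-trans b₁ l₁.word-⊆) (⊆-trans b₂ l₂.word-⊆)
                 (⊆-trans a₁ r₁.word-⊆) (⊆-trans a₂ r₂.word-⊆)
                 (AllPairs-resp-⊆ b₁ l₁.word-Unique) (AllPairs-resp-⊆ a₁ r₁.word-Unique)
                 (λ { (i , j) → d₁₁ (lookup b₁ i , lookup a₁ j) }) = f , (begin
            (length l₁.word + length l₂.word) + (length r₁.word + length r₂.word)
              ≡⟨ cong₂ _+_ eqb eqa ⟩
            (length b + length U) + (length a + length V)
              ≡⟨ swap (length b) (length U) (length a) (length V) ⟩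
            (length U + length V) + (length b + length a)
              ≤⟨ ℕ.+-mono-≤ (ℕ.≤-trans (ℕ.≤-reflexive (sym (List.length-++ U)))
                   (length-Unique-≤ Ω (Unique.++⁺ uU uV λ { (i , j) → apart (incU i) (incV j) }))) le ⟩
            N + (half + score f) ∎)
          where
          open ℕ.≤-Reasoning
          swap : ∀ b u a v → (b + u) + (a + v) ≡ (u + v) + (b + a)
          swap = solve-∀
          apart : ∀ {s} → s ∈ l₁.word ⊎ s ∈ l₂.word → s ∈ r₁.word ⊎ s ∈ r₂.word → ⊥
          apart (inj₁ i) (inj₁ j) = d₁₁ (i , j)
          apart (inj₁ i) (inj₂ j) = d₁₂ (i , j)
          apart (inj₂ i) (inj₁ j) = d₂₁ (i , j)
          apart (inj₂ i) (inj₂ j) = d₂₂ (i , j)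

        total : ℕ
        total = ((length l₁.word + length l₁.tail) + (length l₂.word + length l₂.tail))
              + ((length r₁.word + length r₁.head) + (length r₂.word + length r₂.head))

        private
          straight : total ≡ pair l₁ r₁ + pair l₂ r₂
          straight = straighten (length l₁.word + length l₁.tail) (length l₂.word + length l₂.tail)
                       (length r₁.word + length r₁.head) (length r₂.word + length r₂.head)

          crossed : total ≡ pair l₁ r₂ + pair l₂ r₁
          crossed = cross (length l₁.word + length l₁.tail) (length l₂.word + length l₂.tail)
                      (length r₁.word + length r₁.head) (length r₂.word + length r₂.head)

          overlapping : total ℕ.≤ ((N + N) + Mᴳ) + (N + (Mᴳ + Mᴳ)) →
                        ∃ λ f → total ℕ.≤ 4 *ℕ Mᴳ + (N + (half + score f))
          -- The bound for overlapping words holds whatever the score, so any assignment serves.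
          overlapping le = f , overlapping-total N Mᴳ total (half + score f) refl le
            where
            f : Fin n → Bool
            f _ = false

          -- The total is split into pairs straight or crossed, whichever puts the overlapping left
          -- and right words into one pair; the other pair then obeys `any-pair`.
          by-cases : (∃ λ s → s ∈ l₁.word × s ∈ r₁.word) ⊎ Disjoint l₁.word r₁.word →
                     (∃ λ s → s ∈ l₁.word × s ∈ r₂.word) ⊎ Disjoint l₁.word r₂.word →
                     (∃ λ s → s ∈ l₂.word × s ∈ r₁.word) ⊎ Disjoint l₂.word r₁.word →
                     (∃ λ s → s ∈ l₂.word × s ∈ r₂.word) ⊎ Disjoint l₂.word r₂.word →
                     ∃ λ f → total ℕ.≤ 4 *ℕ Mᴳ + (N + (half + score f))
          by-cases (inj₁ (_ , i , j)) _ _ _ = overlapping (ℕ.≤-trans (ℕ.≤-reflexive straight)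
            (ℕ.+-mono-≤ (overlap-pair l₁ r₁ i j) (any-pair l₂ r₂)))
          by-cases _ (inj₁ (_ , i , j)) _ _ = overlapping (ℕ.≤-trans (ℕ.≤-reflexive crossed)
            (ℕ.+-mono-≤ (overlap-pair l₁ r₂ i j) (any-pair l₂ r₁)))
          by-cases _ _ (inj₁ (_ , i , j)) _ = overlapping (ℕ.≤-trans
            (ℕ.≤-reflexive (trans crossed (ℕ.+-comm (pair l₁ r₂) (pair l₂ r₁))))
            (ℕ.+-mono-≤ (overlap-pair l₂ r₁ i j) (any-pair l₁ r₂)))
          by-cases _ _ _ (inj₁ (_ , i , j)) = overlapping (ℕ.≤-trans
            (ℕ.≤-reflexive (trans straight (ℕ.+-comm (pair l₁ r₁) (pair l₂ r₂))))
            (ℕ.+-mono-≤ (overlap-pair l₂ r₂ i j) (any-pair l₁ r₁)))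
          by-cases (inj₂ d₁₁) (inj₂ d₁₂) (inj₂ d₂₁) (inj₂ d₂₂) =
            let f , le = disjoint-words d₁₁ d₁₂ d₂₁ d₂₂ in f ,
            disjoint-total Mᴳ (N + (half + score f)) (length l₁.word) (length l₂.word) (length r₁.word)
              (length r₂.word) l₁.tail-≤ l₂.tail-≤ r₁.head-≤ r₂.head-≤ le

        total-bound : ∃ λ f → total ℕ.≤ 4 *ℕ Mᴳ + (N + (half + score f))
        total-bound = by-cases (split l₁.word r₁.word) (split l₁.word r₂.word)
                               (split l₂.word r₁.word) (split l₂.word r₂.word)
          where split = common⊎disjoint (Alphabet._≟_ Ω)

      -- The assignment depends on `σ`; a bound common to all permutations comes later from an
      -- assignment of greatest score.
      cost-bound : ∃ λ f → 5 *ℕ half ℕ.≤ medianCost Θ (Π[_] G O) σ + score f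
      cost-bound = f , total-to-cost N Mᴳ half (score f)
        (LCS Θ σ (L₁ G)) (LCS Θ σ (L₂ G)) (LCS Θ σ (R₁ G O)) (LCS Θ σ (R₂ G O))
        N≡half+half (subst (ℕ._≤ 4 *ℕ Mᴳ + (N + (half + score f))) sizes le)
        where
        l₁ = leftWitness (β₁ G)
        l₂ = leftWitness (β₂ G)
        r₁ = rightWitness (α₁ G O)
        r₂ = rightWitness (α₂ G O)
        f = proj₁ (total-bound l₁ l₂ r₁ r₂)
        le = proj₂ (total-bound l₁ l₂ r₁ r₂)
        sizes : total l₁ l₂ r₁ r₂
                  ≡ (LCS Θ σ (L₁ G) + LCS Θ σ (L₂ G)) + (LCS Θ σ (R₁ G O) + LCS Θ σ (R₂ G O))
        sizes = cong₂ _+_ (cong₂ _+_ (LeftWitness.size l₁) (LeftWitness.size l₂))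
                          (cong₂ _+_ (RightWitness.size r₁) (RightWitness.size r₂))

-- Passage to rational numbers

toℚᵘ-fromℕ : ∀ k → toℚᵘ (fromℕ k) ≃ᵘ mkℚᵘ (+ k) 0
toℚᵘ-fromℕ k = ℚ.toℚᵘ-fromℚᵘ (mkℚᵘ (+ k) 0)

-- The normal form of a fraction with a variable numerator does not compute, so the equation is
-- checked over the unnormalised rationals, where cross-multiplication makes it an integer identity.
fromℕ-+ : ∀ a b → fromℕ (a + b) ≡ fromℕ a +ℚ fromℕ b
fromℕ-+ a b = ℚ.toℚᵘ-injective (begin
  toℚᵘ (fromℕ (a + b))                ≈⟨ toℚᵘ-fromℕ (a + b) ⟩
  mkℚᵘ (+ (a + b)) 0                  ≈⟨ *≡* (cong (ℤ._* + 1) (sym (cong₂ ℤ._+_ (ℤ.*-identityʳ (+ a)) (ℤ.*-identityʳ (+ b))))) ⟩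
  mkℚᵘ (+ a) 0 ℚᵘ.+ mkℚᵘ (+ b) 0        ≈⟨ ℚᵘ.+-cong (toℚᵘ-fromℕ a) (toℚᵘ-fromℕ b) ⟨
  toℚᵘ (fromℕ a) ℚᵘ.+ toℚᵘ (fromℕ b)    ≈⟨ ℚ.toℚᵘ-homo-+ (fromℕ a) (fromℕ b) ⟨
  toℚᵘ (fromℕ a +ℚ fromℕ b)              ∎)
  where open ℚᵘ.≃-Reasoning

fromℕ-mono-≤ : ∀ {a b} → a ℕ.≤ b → fromℕ a ≤ fromℕ b
fromℕ-mono-≤ {a} {b} a≤b = ℚ.toℚᵘ-cancel-≤
  (ℚᵘ.≤-trans (ℚᵘ.≤-reflexive (toℚᵘ-fromℕ a))
  (ℚᵘ.≤-trans (*≤* (ℤ.*-monoʳ-≤-nonNeg (+ 1) (ℤ.+≤+ a≤b)))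
    (ℚᵘ.≤-reflexive (ℚᵘ.≃-sym (toℚᵘ-fromℕ b)))))

fromℕ-cancel-≤ : ∀ {a b} → fromℕ a ≤ fromℕ b → a ℕ.≤ b
fromℕ-cancel-≤ {a} {b} le with *≤* le′ ← ℚᵘ.≤-trans (ℚᵘ.≤-reflexive (ℚᵘ.≃-sym (toℚᵘ-fromℕ a)))
  (ℚᵘ.≤-trans (ℚ.toℚᵘ-mono-≤ le) (ℚᵘ.≤-reflexive (toℚᵘ-fromℕ b))) =
  ℤ.drop‿+≤+ (ℤ.*-cancelʳ-≤-pos (+ a) (+ b) (+ 1) le′)

-- The coefficient `5B/2` is not an integer when `B` is odd; its product with `m` is one because
-- `m B = 2h`.
five-halves : ∀ B m h → m *ℕ B ≡ h + h → (+ (5 *ℕ B) / 2) * fromℕ m ≡ fromℕ (5 *ℕ h)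
five-halves B m h eq = ℚ.toℚᵘ-injective (begin
  toℚᵘ ((+ (5 *ℕ B) / 2) * fromℕ m)          ≈⟨ ℚ.toℚᵘ-homo-* (+ (5 *ℕ B) / 2) (fromℕ m) ⟩
  toℚᵘ (+ (5 *ℕ B) / 2) ℚᵘ.* toℚᵘ (fromℕ m)  ≈⟨ ℚᵘ.*-cong (ℚ.toℚᵘ-fromℚᵘ (mkℚᵘ (+ (5 *ℕ B)) 1)) (toℚᵘ-fromℕ m) ⟩
  mkℚᵘ (+ (5 *ℕ B)) 1 ℚᵘ.* mkℚᵘ (+ m) 0      ≈⟨ *≡* numerators ⟩
  mkℚᵘ (+ (5 *ℕ h)) 0                        ≈⟨ toℚᵘ-fromℕ (5 *ℕ h) ⟨
  toℚᵘ (fromℕ (5 *ℕ h))                      ∎)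
  where
  open ℚᵘ.≃-Reasoning
  reorder : ∀ B m → 5 *ℕ B *ℕ m ≡ 5 *ℕ (m *ℕ B)
  reorder = solve-∀
  double : ∀ h → 5 *ℕ (h + h) ≡ 5 *ℕ h *ℕ 2
  double = solve-∀
  numerators : (+ (5 *ℕ B) ℤ.* + m) ℤ.* + 1 ≡ + (5 *ℕ h) ℤ.* + 2
  numerators = trans (ℤ.*-identityʳ _) (trans (sym (ℤ.pos-* (5 *ℕ B) m))
    (trans (cong +_ (trans (reorder B m) (trans (cong (5 *ℕ_) eq) (double h)))) (ℤ.pos-* (5 *ℕ h) 2)))

private
  remove-score : ∀ o s → o ≡ (o +ℚ s) - s
  remove-score = solve 2 (λ o s → o := (o :+ s) :- s) refl
    where open +-*-Solver

  collect-terms : ∀ c a m d v → c * m - (a * m +ℚ d * v) ≡ (c - a) * m - d * v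
  collect-terms = solve 5 (λ c a m d v → c :* m :- (a :* m :+ d :* v) := (c :- a) :* m :- d :* v) refl
    where open +-*-Solver

  step-sat : ∀ a d l v → (a +ℚ d) +ℚ (a * fromℕ l +ℚ d * fromℕ v) ≡ a * fromℕ (suc l) +ℚ d * fromℕ (suc v)
  step-sat a d l v = trans
    (solve 4 (λ a d l v → (a :+ d) :+ (a :* l :+ d :* v)
                := a :* (con ℚ.1ℚ :+ l) :+ d :* (con ℚ.1ℚ :+ v)) refl a d (fromℕ l) (fromℕ v))
    (cong₂ (λ x y → a * x +ℚ d * y) (sym (fromℕ-+ 1 l)) (sym (fromℕ-+ 1 v)))
    where open +-*-Solver

  step-unsat : ∀ a d l v → a +ℚ (a * fromℕ l +ℚ d * v) ≡ a * fromℕ (suc l) +ℚ d * v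
  step-unsat a d l v = trans
    (solve 4 (λ a d l v → a :+ (a :* l :+ d :* v) := a :* (con ℚ.1ℚ :+ l) :+ d :* v) refl a d (fromℕ l) v)
    (cong (λ x → a * x +ℚ d * v) (sym (fromℕ-+ 1 l)))
    where open +-*-Solver

-- Every index contributes `A`, and each index kept by the filter a further `Δ`.
weighted-sum : ∀ {I : Set} (L : I → ℕ) (sat : I → Bool) {A Δ} →
               (∀ j → fromℕ (L j) ≡ (if sat j then A +ℚ Δ else A)) → ∀ js →
               fromℕ (sum (map L js))
                 ≡ A * fromℕ (length js) +ℚ Δ * fromℕ (length (filter (λ j → sat j Bool.≟ true) js))
weighted-sum L sat {A} {Δ} h [] = solve 2 (λ a d → con 0ℚ := a :* con 0ℚ :+ d :* con 0ℚ) refl A Δ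
  where open +-*-Solver
weighted-sum L sat {A} {Δ} h (j ∷ js)
  with ih ← trans (fromℕ-+ (L j) (sum (map L js))) (cong₂ _+ℚ_ (h j) (weighted-sum L sat h js))
  with sat j
... | true  = trans ih (step-sat A Δ (length js) (length (filter (λ i → sat i Bool.≟ true) js)))
... | false = trans ih (step-unsat A Δ (length js) (fromℕ (length (filter (λ i → sat i Bool.≟ true) js))))

-- The hypothesis is on `o + s`, so that subtraction takes place only in `ℚ`, where it does not
-- truncate.
value-from-total : ∀ {B m h o s v A Δ} → m *ℕ B ≡ h + h → o + s ≡ 5 *ℕ h →
                   fromℕ s ≡ A * fromℕ m +ℚ Δ * fromℕ v →
                   fromℕ o ≡ ((+ (5 *ℕ B) / 2) - A) * fromℕ m - Δ * fromℕ v
value-from-total {B} {m} {h} {o} {s} {v} {A} {Δ} mB total score≡ = begin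
  fromℕ o
    ≡⟨ remove-score (fromℕ o) (fromℕ s) ⟩
  (fromℕ o +ℚ fromℕ s) - fromℕ s
    ≡⟨ cong₂ _-_ (trans (sym (fromℕ-+ o s)) (trans (cong fromℕ total) (sym (five-halves B m h mB)))) score≡ ⟩
  (+ (5 *ℕ B) / 2) * fromℕ m - (A * fromℕ m +ℚ Δ * fromℕ v)
    ≡⟨ collect-terms (+ (5 *ℕ B) / 2) A (fromℕ m) Δ (fromℕ v) ⟩
  ((+ (5 *ℕ B) / 2) - A) * fromℕ m - Δ * fromℕ v ∎
  where open ≡-Reasoning

-- The CSP optimum and the score

∈-assignments : ∀ {n} (f : Fin n → Bool) → ∃ λ g → g ∈ assignments n × (∀ x → g x ≡ f x)
∈-assignments {zero} f = _ , here refl , λ ()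
∈-assignments {suc n} f with g , i , eq ← ∈-assignments (f ∘ Fin.suc) =
  f Fin.zero ∷ᶠ g , ∈-concatMap⁺ _ (Any.map (λ {refl → extend (f Fin.zero)}) i)
  , λ { Fin.zero → refl ; (Fin.suc x) → eq x }
  where
  extend : ∀ b → (b ∷ᶠ g) ∈ (false ∷ᶠ g) ∷ (true ∷ᶠ g) ∷ []
  extend false = here refl
  extend true  = there (here refl)

module _ {n m : ℕ} (φ : CSP n m) where

  -- `∈-assignments` finds an assignment only up to pointwise equality; this carries its value over
  -- to the listed copy.
  Val-cong : ∀ {f g : Fin n → Bool} → (∀ x → f x ≡ g x) → Val φ f ≡ Val φ g
  Val-cong {f} {g} eq = cong length (List.filter-≐ _ _
    ((λ {j} e → trans (sym (sat-eq j)) e) , λ {j} e → trans (sat-eq j) e) (allFin m))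
    where
    sat-eq : ∀ j → Constraint.sat (φ j) (f ∘ proj₁) ≡ Constraint.sat (φ j) (g ∘ proj₁)
    sat-eq j = Constraint.sat-cong (φ j) (λ x → eq (proj₁ x))

  Val≤OPTcsp : ∀ f → Val φ f ℕ.≤ OPTcsp φ
  Val≤OPTcsp f with g , i , eq ← ∈-assignments f = subst (ℕ._≤ OPTcsp φ) (Val-cong eq)
    (All.lookup (xs≤max 0 (map (Val φ) (assignments n))) (∈-map⁺ (Val φ) i))

  OPTcsp-attained : ∃ λ f → Val φ f ≡ OPTcsp φ
  OPTcsp-attained with argmax-sel (λ k → k) 0 (map (Val φ) (assignments n))
  -- If the maximum is the default `0`, every value is `0` and any assignment attains it.
  ... | inj₁ eq = (λ _ → true) , ℕ.≤-antisym (Val≤OPTcsp _) (ℕ.≤-trans (ℕ.≤-reflexive eq) z≤n)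
  ... | inj₂ i with f , _ , eq ← ∈-map⁻ (Val φ) i = f , sym eq

  score-value : ∀ {B A Δ} (G : Gadgets φ B) → (∀ j → LocalScore (G j) A Δ) → ∀ f →
                fromℕ (score φ G f) ≡ A * fromℕ m +ℚ Δ * fromℕ (Val φ f)
  score-value {B} {A} {Δ} G local f = trans
    (weighted-sum (λ j → LCS (Gadget.alphabet (G j)) (agreeing φ G f j) (agreeing′ φ G f j))
      (λ j → Constraint.sat (φ j) (f ∘ proj₁)) (λ j → local j (f ∘ proj₁)) (allFin m))
    (cong (λ k → A * fromℕ k +ℚ Δ * fromℕ (Val φ f)) (List.length-tabulate {n = m} (λ i → i)))

  -- By `score-value` the score is an affine function of the value with slope `Δ > 0`, so an
  -- assignment of greatest value has greatest score.
  score-mono : ∀ {B A Δ} (G : Gadgets φ B) → (∀ j → LocalScore (G j) A Δ) → 0ℚ < Δ →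
               ∀ {f g} → Val φ f ℕ.≤ Val φ g → score φ G f ℕ.≤ score φ G g
  score-mono {A = A} {Δ} G local 0<Δ {f} {g} le = fromℕ-cancel-≤ {score φ G f} {score φ G g}
    (subst₂ _≤_ (sym (score-value G local f)) (sym (score-value G local g))
      (ℚ.+-monoʳ-≤ (A * fromℕ m) (ℚ.*-monoˡ-≤-nonNeg Δ {{ℚ.pos⇒nonNeg Δ {{ℚ.positive 0<Δ}}}}
        (fromℕ-mono-≤ le))))

-- The two bounds combined

theorem4p3 : ∀ {n m : ℕ} (φ : CSP n m)
    (B : ℕ) .{{_ : NonZero B}} (A Δ : ℚ) → 0ℚ ≤ A → 0ℚ < Δ →
    (G : Gadgets φ B) → (∀ j → LocalScore (G j) A Δ) →
    Balanced G → (O : BlockOrder G) →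
    fromℕ (OPTmed (medianAlphabet G) (Π[_] G O))
    ≡ ((+ (5 *ℕ B) / 2) - A) * fromℕ m - Δ * fromℕ (OPTcsp φ)
theorem4p3 {n} {m} φ B A Δ _ 0<Δ G local balanced O =
  subst (λ v → fromℕ opt ≡ ((+ (5 *ℕ B) / 2) - A) * fromℕ m - Δ * fromℕ v) f-optimal
    (value-from-total {B} {m} {h} {opt} {s} {Val φ f} {A} {Δ} (N≡half+half φ G balanced O)
      (ℕ.≤-antisym upper lower) (score-value φ G local f))
  where
  -- An optimal assignment serves twice: `upper` builds a permutation from it, and `lower` needs its
  -- score to be the greatest.
  f = proj₁ (OPTcsp-attained φ)
  f-optimal = proj₂ (OPTcsp-attained φ)
  s = score φ G f
  h = half φ G balanced O
  opt = OPTmed (medianAlphabet G) (Π[_] G O)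

  score-max : ∀ g → score φ G g ℕ.≤ s
  score-max g = score-mono φ G local 0<Δ {g} {f} (ℕ.≤-trans (Val≤OPTcsp φ g) (ℕ.≤-reflexive (sym f-optimal)))

  lower : 5 *ℕ h ℕ.≤ opt + s
  lower = ℕ.≤-trans (ℕ.m≤n+m∸n (5 *ℕ h) s) (ℕ.≤-trans
    (ℕ.+-monoʳ-≤ s (≤-OPTmed (medianAlphabet G) (Π[_] G O) each)) (ℕ.≤-reflexive (ℕ.+-comm s opt)))
    where
    each : ∀ {w} → IsPermutation (medianAlphabet G) w →
           5 *ℕ h ∸ s ℕ.≤ medianCost (medianAlphabet G) (Π[_] G O) w
    -- `cost-bound` supplies an assignment depending on `w`; its score is at most `s`, which makes
    -- the bound uniform in `w`.
    each {w} (u , _) = let g , le = cost-bound φ G balanced O u in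
      ℕ.m≤n+o⇒m∸n≤o (5 *ℕ h) s (ℕ.≤-trans le (ℕ.≤-trans (ℕ.+-monoʳ-≤ c (score-max g)) (ℕ.≤-reflexive (ℕ.+-comm c s))))
      where c = medianCost (medianAlphabet G) (Π[_] G O) w

  upper : opt + s ℕ.≤ 5 *ℕ h
  upper = ℕ.≤-trans
    (ℕ.+-monoˡ-≤ s (OPTmed-≤ (medianAlphabet G) (Π[_] G O) (median-IsPermutation φ G balanced O f)))
    (median-cost φ G balanced O f)
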